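{- A poset is a geometric semilattice if and only if it is isomorphic to the poset of flats of a semimatroid. Furthermore, each geometric semilattice is the poset of flats of a unique simple semimatroid, up to isomorphism.
   Context: $\mathbb{N}$ includes $0$; matroids and semimatroids have finite ground sets. A simplicial complex on a finite set $S$ is a family of subsets of $S$ closed under taking subsets; singletons need not belong to it. A semimatroid is a triple $(S,\mathcal{C},r_{\mathcal{C}})$ consisting of a finite set $S$, a non-empty simplicial complex $\mathcal{C}$ on $S$, and a function $r_{\mathcal{C}}:\mathcal{C}\to\mathbb{N}$ such that: (R1) if $X\in\mathcal{C}$ then $0\le r_{\mathcal{C}}(X)\le |X|$; (R2) if $X,Y\in\mathcal{C}$ and $X\subseteq Y$ then $r_{\mathcal{C}}(X)\le r_{\mathcal{C}}(Y)$; (R3) if $X,Y\in\mathcal{C}$ and $X\cup Y\in\mathcal{C}$ then $r_{\mathcal{C}}(X)+r_{\mathcal{C}}(Y)\ge r_{\mathcal{C}}(X\cup Y)+r_{\mathcal{C}}(X\cap Y)$; (CR1) if $X,Y\in\mathcal{C}$ and $r_{\mathcal{C}}(X)=r_{\mathcal{C}}(X\cap Y)$ then $X\cup Y\in\mathcal{C}$; (CR2) if $X,Y\in\mathcal{C}$ and $r_{\mathcal{C}}(X)<r_{\mathcal{C}}(Y)$ then $X\cup\{y\}\in\mathcal{C}$ for some $y\in Y-X$. For $X\in\mathcal{C}$ the closure is $\mathrm{cl}_{\mathcal{C}}(X)=\{x\in S\mid X\cup\{x\}\in\mathcal{C},\ r_{\mathcal{C}}(X\cup\{x\})=r_{\mathcal{C}}(X)\}$.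 A flat is a set $A\in\mathcal{C}$ with $\mathrm{cl}_{\mathcal{C}}(A)=A$; the poset of flats is the set of flats ordered by containment. The semimatroid is simple if $\{x\}\in\mathcal{C}$ and $r_{\mathcal{C}}(\{x\})=1$ for all $x\in S$, and $r_{\mathcal{C}}(\{x,y\})=2$ for all $\{x,y\}\in\mathcal{C}$ with $x\ne y$. Two semimatroids $(S_1,\mathcal{C}_1,r_{\mathcal{C}_1})$, $(S_2,\mathcal{C}_2,r_{\mathcal{C}_2})$ are isomorphic if there is a bijection $f:S_1\to S_2$ inducing an isomorphism of simplicial complexes $f:\mathcal{C}_1\to\mathcal{C}_2$ with $r_{\mathcal{C}_1}(c)=r_{\mathcal{C}_2}(f(c))$ for all $c\in\mathcal{C}_1$. A meet semilattice is a poset $K$ such that every non-empty subset has a greatest lower bound (meet); it has a minimum element $\hat{0}$. If a subset of $K$ has an upper bound, then it has a least upper bound (join) $\vee$. $K$ is ranked with rank function $r:K\to\mathbb{N}$ if for all $x\in K$ every maximal chain from $\hat{0}$ to $x$ has the same length $r(x)$. An atom is an element of rank $1$. A set $A$ of atoms is independent if it has an upper bound and $r(\vee A)=|A|$. A geometric semilattice is a ranked meet semilattice such that: (G1) every element is a join of atoms ($\hat{0}$ being the empty join); (G2) the collection of independent sets of atoms is the collection of independent sets of a matroid (on the set of atoms, which is finite). -}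

module Defs where

open import Data.Fin.Base using (Fin)
open import Data.Fin.Properties using (any?) renaming (_≟_ to _≟ᶠ_)
open import Data.Fin.Subset using (Subset; _∈_; _∉_; _⊆_; _∪_; _∩_; ⁅_⁆; ∣_∣; ⊥)
open import Data.Fin.Subset.Properties using (_∈?_; p∩q⊆p; ⊆-poset)
open import Data.Nat.Base using (ℕ; suc; _+_; _≤_; _<_; _≥_)
open import Data.Product.Base using (Σ; Σ-syntax; ∃; ∃-syntax; _×_; _,_; proj₁; proj₂)
open import Data.Sum.Base using (_⊎_)
open import Data.Vec.Base using (tabulate)
open import Function.Bundles using (Bijection; _⇔_; module Equivalence)
open import Function.Definitions using (Bijective)
open import Level using (Level; _⊔_; 0ℓ; Lift) renaming (suc to lsuc)
open import Relation.Binary.Bundles using (Poset; Setoid)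
open import Relation.Binary.Construct.On as On using ()
open import Relation.Binary.Core using (_Preserves_⟶_)
open import Relation.Binary.Definitions using (Minimum)
open import Relation.Binary.Morphism.Structures using (IsOrderIsomorphism)
open import Relation.Binary.PropositionalEquality.Core using (_≡_; _≢_)
open import Relation.Binary.PropositionalEquality.Properties using (setoid)
open import Relation.Nullary.Decidable using (does; _×-dec_)
open import Relation.Unary using (Pred; Satisfiable; _≐_) renaming (_⊆_ to _⊆ᵖ_)

-- The ground set is Fin n.  Faces are the members of the complex; singletons
-- need not be faces.
record SimplicialComplex (n : ℕ) : Set₁ where
  field
    Face   : Pred (Subset n) 0ℓ
    closed : ∀ {X Y} → X ⊆ Y → Face Y → Face X

-- The rank is defined on faces only.  Its second argument is irrelevant, so
-- that the value depends on the face and not on the proof of its being one.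
record Semimatroid (n : ℕ) : Set₁ where
  field
    complex : SimplicialComplex n
  open SimplicialComplex complex public
  field
    nonEmpty : Satisfiable Face
    rank     : (X : Subset n) → .(Face X) → ℕ
    R1  : ∀ X (fX : Face X) → rank X fX ≤ ∣ X ∣
    R2  : ∀ X Y (fX : Face X) (fY : Face Y) → X ⊆ Y → rank X fX ≤ rank Y fY
    R3  : ∀ X Y (fX : Face X) (fY : Face Y) (fX∪Y : Face (X ∪ Y)) →
          rank X fX + rank Y fY
            ≥ rank (X ∪ Y) fX∪Y + rank (X ∩ Y) (closed (p∩q⊆p X Y) fX)
    CR1 : ∀ X Y (fX : Face X) (fY : Face Y) →
          rank X fX ≡ rank (X ∩ Y) (closed (p∩q⊆p X Y) fX) → Face (X ∪ Y)
    CR2 : ∀ X Y (fX : Face X) (fY : Face Y) → rank X fX < rank Y fY →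
          ∃[ y ] y ∈ Y × y ∉ X × Face (X ∪ ⁅ y ⁆)

  closure : (X : Subset n) → .(Face X) → Pred (Fin n) 0ℓ
  closure X fX x =
    Σ[ fX∪x ∈ Face (X ∪ ⁅ x ⁆) ] rank (X ∪ ⁅ x ⁆) fX∪x ≡ rank X fX

  IsFlat : Pred (Subset n) 0ℓ
  IsFlat A = Σ[ fA ∈ Face A ] closure A fA ≐ (_∈ A)

  IsSimple : Set
  IsSimple =
    (∀ x → Σ[ fx ∈ Face ⁅ x ⁆ ] rank ⁅ x ⁆ fx ≡ 1) ×
    (∀ x y → x ≢ y → (fxy : Face (⁅ x ⁆ ∪ ⁅ y ⁆)) → rank (⁅ x ⁆ ∪ ⁅ y ⁆) fxy ≡ 2)

  -- Flats are equal when their underlying sets are.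
  flats : Poset 0ℓ 0ℓ 0ℓ
  flats = On.poset {B = ∃ IsFlat} (⊆-poset n) proj₁

open Semimatroid public using (IsSimple; flats)

image : ∀ {m n} → (Fin m → Fin n) → Subset m → Subset n
image f X = tabulate λ y → does (any? λ x → (x ∈? X) ×-dec (f x ≟ᶠ y))

record _≅ₛ_ {m n : ℕ} (M : Semimatroid m) (N : Semimatroid n) : Set where
  private
    module M = Semimatroid M
    module N = Semimatroid N
  field
    f         : Fin m → Fin n
    bijective : Bijective _≡_ _≡_ f
    face⇔     : ∀ X → M.Face X ⇔ N.Face (image f X)
    rank≡     : ∀ X (fX : M.Face X) →
                M.rank X fX ≡ N.rank (image f X) (Equivalence.to (face⇔ X) fX)

-- Indep is the collection of independent sets of a matroid on Fin n.
record IsMatroid {n : ℕ} {ℓ : Level} (Indep : Pred (Subset n) ℓ) : Set ℓ where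
  field
    empty        : Indep ⊥
    hereditary   : ∀ {X Y} → X ⊆ Y → Indep Y → Indep X
    augmentation : ∀ {X Y} → Indep X → Indep Y → ∣ X ∣ < ∣ Y ∣ →
                   ∃[ y ] y ∈ Y × y ∉ X × Indep (X ∪ ⁅ y ⁆)

record _≅ₚ_ {a b c d e f} (P : Poset a b c) (Q : Poset d e f) :
            Set (a ⊔ b ⊔ c ⊔ d ⊔ e ⊔ f) where
  private
    module P = Poset P
    module Q = Poset Q
  field
    to            : P.Carrier → Q.Carrier
    isIsomorphism : IsOrderIsomorphism P._≈_ Q._≈_ P._≤_ Q._≤_ to

module _ {c ℓ₁ ℓ₂ : Level} (K : Poset c ℓ₁ ℓ₂) where

  open Poset K using (Carrier; _≈_; module Eq) renaming (_≤_ to _⊑_)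

  private
    ℓ : Level
    ℓ = c ⊔ ℓ₁ ⊔ ℓ₂

  IsUpperBound : Pred Carrier ℓ → Pred Carrier ℓ
  IsUpperBound P u = ∀ {x} → P x → x ⊑ u

  IsLowerBound : Pred Carrier ℓ → Pred Carrier ℓ
  IsLowerBound P l = ∀ {x} → P x → l ⊑ x

  IsJoin : Pred Carrier ℓ → Pred Carrier ℓ
  IsJoin P j = IsUpperBound P j × (∀ u → IsUpperBound P u → j ⊑ u)

  IsMeet : Pred Carrier ℓ → Pred Carrier ℓ
  IsMeet P m = IsLowerBound P m × (∀ l → IsLowerBound P l → l ⊑ m)

  -- Elements of a subset are counted up to the equality _≈_ of the poset.
  subsetoid : ∀ {p} → Pred Carrier p → Setoid (c ⊔ p) ℓ₁
  subsetoid P = On.setoid {B = ∃ P} Eq.setoid proj₁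

  HasSize : ∀ {p} → Pred Carrier p → ℕ → Set (c ⊔ ℓ₁ ⊔ p)
  HasSize P k = Bijection (setoid (Fin k)) (subsetoid P)

  record IsChainFromTo (a b : Carrier) (C : Pred Carrier ℓ) : Set ℓ where
    field
      start   : C a
      end     : C b
      between : ∀ {x} → C x → a ⊑ x × x ⊑ b
      total   : ∀ {x y} → C x → C y → x ⊑ y ⊎ y ⊑ x

  IsMaximalChainFromTo : (a b : Carrier) → Pred Carrier ℓ → Set (lsuc ℓ)
  IsMaximalChainFromTo a b C =
    IsChainFromTo a b C × (∀ D → IsChainFromTo a b D → C ⊆ᵖ D → D ⊆ᵖ C)

  record IsMeetSemilattice : Set (lsuc ℓ) where
    field
      -- The minimum is the meet of all elements; having it as a field also
      -- rules out the empty poset.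
      meets   : ∀ (P : Pred Carrier ℓ) → Satisfiable P → ∃ (IsMeet P)
      0̂       : Carrier
      minimum : Minimum _⊑_ 0̂

  -- A chain of length k has k + 1 elements.  Chains are arbitrary subsets, so
  -- this also says that maximal chains are finite.
  record IsRankFunction (0̂ : Carrier) (r : Carrier → ℕ) : Set (lsuc ℓ) where
    field
      cong   : r Preserves _≈_ ⟶ _≡_
      length : ∀ x C → IsMaximalChainFromTo 0̂ x C → HasSize C (suc (r x))

  module _ (r : Carrier → ℕ) where

    IsAtom : Pred Carrier 0ℓ
    IsAtom x = r x ≡ 1

    -- Intended for sets A of atoms.  In a meet semilattice, a set with an upper bound has
    -- a join, so asking for the join also asks for an upper bound.
    Independent : Pred (Pred Carrier ℓ) ℓ
    Independent A = ∃[ j ] IsJoin A j × HasSize A (r j)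

  record IsGeometricSemilattice : Set (lsuc ℓ) where
    field
      isMeetSemilattice : IsMeetSemilattice
    open IsMeetSemilattice isMeetSemilattice public
    field
      r              : Carrier → ℕ
      isRankFunction : IsRankFunction 0̂ r
      G1             : ∀ x → ∃[ A ] A ⊆ᵖ IsAtom r × IsJoin A x
      atomCount      : ℕ
      atoms          : HasSize (IsAtom r) atomCount

    -- Subsets of the finite set of atoms are given as sets of indices.
    atomSet : Subset atomCount → Pred Carrier ℓ
    atomSet X x = Lift ℓ (∃[ i ] i ∈ X × proj₁ (Bijection.to atoms i) ≈ x)

    field
      G2 : IsMatroid λ X → Independent r (atomSet X)

{-# OPTIONS --safe #-}
module Submission where

-- Both notions amount to a rank function on a poset with finitely many atoms, such that
-- elements are determined by the atoms below them, joining an element with an atom outside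
-- it raises the rank by exactly one, and (CR2) holds for sets of atoms (AtomicRank and
-- Exchange below).  For the poset of flats this follows from the properties of closure.  In a
-- geometric semilattice, bases extend along maximal chains, so that heredity of independence
-- gives the rank increase and augmentation gives the exchange property.  Conversely, the
-- increase by one yields the submodular law, and hence (R3) and the independence axioms; the
-- bounded sets of atoms are the faces of the simple semimatroid.  A simple semimatroid is
-- recovered from its flats: its points are the atoms, its faces are the bounded sets of
-- atoms, and the rank function of the poset is unique.

open import Defs
open import Axiom.ExcludedMiddle using (ExcludedMiddle)
open import Data.Bool.Base using (true; false)
open import Data.Fin.Base using (Fin; zero; suc; toℕ; fromℕ<)
open import Data.Fin.Properties
  using (injective⇒≤; any?; toℕ-injective; toℕ-fromℕ<; toℕ<n)
  renaming (_≟_ to _≟ᶠ_)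
open import Data.Fin.Subset using (Subset; _∈_; _∉_; _⊆_; _∪_; _∩_; _─_; ⁅_⁆; ∣_∣; ⊥)
open import Data.Fin.Subset.Properties
open import Data.Nat.Base hiding (_⊔_)
open import Data.Nat.Induction using (<-wellFounded)
open import Data.Nat.Properties
open import Data.Product.Base
  using (Σ-syntax; ∃; ∃-syntax; _×_; _,_; proj₁; proj₂)
open import Data.Sum.Base using (_⊎_; inj₁; inj₂; [_,_]′; map₁; map₂)
open import Data.Vec.Base using (_∷_; []; tabulate; here; there)
open import Data.Vec.Properties using (lookup∘tabulate; []=⇒lookup; lookup⇒[]=)
open import Function.Base using (_∘_; id)
open import Function.Bundles using (Bijection; _⇔_; mk⇔; module Equivalence)
open import Induction.WellFounded using (Acc; acc)
open import Level using (Level; _⊔_; 0ℓ; Lift; lift; lower)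
open import Relation.Binary.Bundles using (Poset; Setoid)
open import Relation.Binary.Morphism.Structures using (IsOrderIsomorphism)
open import Relation.Binary.PropositionalEquality
  using (_≡_; refl; sym; trans; cong; subst; subst₂)
open import Relation.Nullary using (¬_; Dec; yes; no; does; contradiction)
open import Relation.Nullary.Decidable
  using (_×-dec_; dec-true; True; toWitness; fromWitness; decidable-stable; map′)
open import Relation.Unary using (Pred; Decidable)

-- Classical tools

lower-em : ∀ {p} q → ExcludedMiddle (p ⊔ q) → ExcludedMiddle p
lower-em q em = map′ lower lift (em {Lift q _})

abstract
  -- Descent on `μ`, with excluded middle deciding at each stage whether a smaller value exists.
  -- With a complement such as `n ∸ ∣ Y ∣` as `μ`, it yields sets of maximal size.
  minimise : ∀ {a q} → ExcludedMiddle (a ⊔ q) → {A : Set a} (μ : A → ℕ) (Q : Pred A q) →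
             ∀ {x} → Q x → ∃[ y ] Q y × (∀ z → Q z → μ y ≤ μ z)
  minimise em {A} μ Q {x} qx = go qx (<-wellFounded (μ x))
    where
    go : ∀ {x} → Q x → Acc _<_ (μ x) → ∃[ y ] Q y × (∀ z → Q z → μ y ≤ μ z)
    go {x} qx (acc rs) with em {∃[ z ] Q z × μ z < μ x}
    ... | yes (z , qz , lt) = go qz (rs lt)
    ... | no  none = x , qx , λ z qz → ≮⇒≥ λ lt → none (z , qz , lt)

-- Subsets of Fin n

⟦_⟧ : ∀ {n p} {P : Pred (Fin n) p} → Decidable P → Subset n
⟦ P? ⟧ = tabulate (does ∘ P?)

module _ {n p} {P : Pred (Fin n) p} (P? : Decidable P) {i : Fin n} where

  ∈⟦⟧⁺ : P i → i ∈ ⟦ P? ⟧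
  ∈⟦⟧⁺ pi = lookup⇒[]= i _ (trans (lookup∘tabulate (does ∘ P?) i) (dec-true (P? i) pi))

  ∈⟦⟧⁻ : i ∈ ⟦ P? ⟧ → P i
  ∈⟦⟧⁻ i∈ = does-true (P? i) (trans (sym (lookup∘tabulate (does ∘ P?) i)) ([]=⇒lookup i∈))
    where
    does-true : ∀ {a} {A : Set a} (a? : Dec A) → does a? ≡ true → A
    does-true (yes a) _ = a

x∈image⁺ : ∀ {m n} (f : Fin m → Fin n) {X x} → x ∈ X → f x ∈ image f X
x∈image⁺ f {X} {x} x∈X = ∈⟦⟧⁺ (λ y → any? λ x → (x ∈? X) ×-dec (f x ≟ᶠ y)) (x , x∈X , refl)

x∈image⁻ : ∀ {m n} (f : Fin m → Fin n) {X y} → y ∈ image f X → ∃[ x ] x ∈ X × f x ≡ y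
x∈image⁻ f {X} = ∈⟦⟧⁻ (λ y → any? λ x → (x ∈? X) ×-dec (f x ≟ᶠ y))

∪-lub : ∀ {n} {p q r : Subset n} → p ⊆ r → q ⊆ r → p ∪ q ⊆ r
∪-lub {p = p} {q} p⊆r q⊆r x∈ = [ p⊆r , q⊆r ]′ (x∈p∪q⁻ p q x∈)

⁅⁆⊆ : ∀ {n} {p : Subset n} {x} → x ∈ p → ⁅ x ⁆ ⊆ p
⁅⁆⊆ {p = p} {x} x∈p y∈ = subst (_∈ p) (sym (x∈⁅y⁆⇒x≡y x y∈)) x∈p

x∈p∪⁅x⁆ : ∀ {n} (p : Subset n) x → x ∈ p ∪ ⁅ x ⁆
x∈p∪⁅x⁆ p x = q⊆p∪q p ⁅ x ⁆ (x∈⁅x⁆ x)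

∣p∪⁅x⁆∣≡1+∣p∣ : ∀ {n} (p : Subset n) {x} → x ∉ p → ∣ p ∪ ⁅ x ⁆ ∣ ≡ suc ∣ p ∣
∣p∪⁅x⁆∣≡1+∣p∣ (true  ∷ p) {zero}  x∉ = contradiction here x∉
∣p∪⁅x⁆∣≡1+∣p∣ (false ∷ p) {zero}  x∉ = cong (suc ∘ ∣_∣) (∪-identityʳ p)
∣p∪⁅x⁆∣≡1+∣p∣ (true  ∷ p) {suc x} x∉ = cong suc (∣p∪⁅x⁆∣≡1+∣p∣ p (x∉ ∘ there))
∣p∪⁅x⁆∣≡1+∣p∣ (false ∷ p) {suc x} x∉ = ∣p∪⁅x⁆∣≡1+∣p∣ p (x∉ ∘ there)

p⊆q⇒∣q─p∣+∣p∣≡∣q∣ : ∀ {n} {p q : Subset n} → p ⊆ q → ∣ q ─ p ∣ + ∣ p ∣ ≡ ∣ q ∣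
p⊆q⇒∣q─p∣+∣p∣≡∣q∣ {p = []}        {[]}        _   = refl
p⊆q⇒∣q─p∣+∣p∣≡∣q∣ {p = true ∷ p}  {true ∷ q}  p⊆q =
  trans (+-suc _ ∣ p ∣) (cong suc (p⊆q⇒∣q─p∣+∣p∣≡∣q∣ (drop-∷-⊆ p⊆q)))
p⊆q⇒∣q─p∣+∣p∣≡∣q∣ {p = true ∷ p}  {false ∷ q} p⊆q with () ← p⊆q here
p⊆q⇒∣q─p∣+∣p∣≡∣q∣ {p = false ∷ p} {true ∷ q}  p⊆q =
  cong suc (p⊆q⇒∣q─p∣+∣p∣≡∣q∣ (drop-∷-⊆ p⊆q))
p⊆q⇒∣q─p∣+∣p∣≡∣q∣ {p = false ∷ p} {false ∷ q} p⊆q = p⊆q⇒∣q─p∣+∣p∣≡∣q∣ (drop-∷-⊆ p⊆q)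

∪⁅⁆-induction : ∀ {n p} (P : Pred (Subset n) p) → P ⊥ →
                (∀ X {x} → x ∉ X → P X → P (X ∪ ⁅ x ⁆)) → ∀ X → P X
∪⁅⁆-induction P base step []          = base
-- The tail is built first, with `zero` absent; `zero` itself is inserted last.
∪⁅⁆-induction P base step (s ∷ X) with ∪⁅⁆-induction (P ∘ (false ∷_)) base
  (λ Y x∉ → step (false ∷ Y) (x∉ ∘ drop-there)) X
∪⁅⁆-induction P base step (false ∷ X) | P-X = P-X
∪⁅⁆-induction P base step (true  ∷ X) | P-X =
  subst (P ∘ (true ∷_)) (∪-identityʳ X) (step (false ∷ X) {zero} (λ ()) P-X)

-- Finite sets up to setoid equality

module _ {a e} (em : ExcludedMiddle e) (em₀ : ExcludedMiddle 0ℓ) (S : Setoid a e) where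

  open Setoid S using (Carrier; _≈_) renaming (refl to ≈-refl; sym to ≈-sym)

  abstract
    -- Picks one index from each class of `_≈_` among the values of `s` on `P`. It lists the atoms
    -- of a poset of flats, where parallel points of the ground set yield the same atom.
    transversal : ∀ {m} (s : Fin m → Carrier) (P : Fin m → Set) →
      ∃[ k ] Σ[ t ∈ (Fin k → Fin m) ]
        (∀ i → P (t i)) × (∀ {i j} → s (t i) ≈ s (t j) → i ≡ j) ×
        (∀ i → P i → ∃[ j ] s (t j) ≈ s i)
    transversal {zero}  s P = 0 , (λ ()) , (λ ()) , (λ {}) , λ ()
    transversal {suc m} s P with transversal (s ∘ suc) (P ∘ suc)
    ... | k , t , Pt , inj , cov with em₀ {P zero} | em {∃[ j ] s (suc (t j)) ≈ s zero}
    ... | no ¬P0 | _ =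
      k , suc ∘ t , Pt , inj ,
      λ { zero P0 → contradiction P0 ¬P0 ; (suc i) Pi → cov i Pi }
    ... | yes P0 | yes old =
      k , suc ∘ t , Pt , inj , λ { zero _ → old ; (suc i) Pi → cov i Pi }
    ... | yes P0 | no new = suc k , t′ , Pt′ , inj′ , cov′
      where
      t′ : Fin (suc k) → Fin (suc m)
      t′ zero    = zero
      t′ (suc j) = suc (t j)
      Pt′ : ∀ i → P (t′ i)
      Pt′ zero    = P0
      Pt′ (suc i) = Pt i
      inj′ : ∀ {i j} → s (t′ i) ≈ s (t′ j) → i ≡ j
      inj′ {zero}  {zero}  _ = refl
      inj′ {zero}  {suc j} e = contradiction (j , ≈-sym e) new
      inj′ {suc i} {zero}  e = contradiction (i , e) new
      inj′ {suc i} {suc j} e = cong suc (inj e)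
      cov′ : ∀ i → P i → ∃[ j ] s (t′ j) ≈ s i
      cov′ zero    _  = zero , ≈-refl
      cov′ (suc i) Pi with j , e ← cov i Pi = suc j , e

module _ {c ℓ₁ ℓ₂} (K : Poset c ℓ₁ ℓ₂) where

  open Poset K using (Carrier; _≈_; module Eq)

  hasSize : ∀ {p} {P : Pred Carrier p} {k} (f : Fin k → Carrier) → (∀ i → P (f i)) →
            (∀ {i j} → f i ≈ f j → i ≡ j) → (∀ {x} → P x → ∃[ i ] f i ≈ x) → HasSize K P k
  hasSize f Pf inj surj = record
    { to        = λ i → f i , Pf i
    ; cong      = λ { refl → Eq.refl }
    ; bijective = inj , λ { (_ , px) → let i , e = surj px in i , λ { refl → e } }
    }

  module _ {p} {P : Pred Carrier p} {k} (size : HasSize K P k) where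

    element : Fin k → Carrier
    element = proj₁ ∘ Bijection.to size

    element-satisfies : ∀ i → P (element i)
    element-satisfies = proj₂ ∘ Bijection.to size

    element-injective : ∀ {i j} → element i ≈ element j → i ≡ j
    element-injective = Bijection.injective size

    element-surjective : ∀ {x} → P x → ∃[ i ] element i ≈ x
    element-surjective px with i , e ← Bijection.surjective size (_ , px) = i , e refl

  hasSize-mono : ∀ {p q} {P : Pred Carrier p} {Q : Pred Carrier q} {k l} →
                 (∀ {x} → P x → Q x) → HasSize K P k → HasSize K Q l → k ≤ l
  hasSize-mono P⊆Q sP sQ = injective⇒≤ {f = λ i → proj₁ (index i)} λ {i} {j} e →
    element-injective sP (Eq.trans (Eq.sym (proj₂ (index i)))
      (Eq.trans (Eq.reflexive (cong (element sQ) e)) (proj₂ (index j))))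
    where
    index : ∀ i → ∃[ j ] element sQ j ≈ element sP i
    index i = element-surjective sQ (P⊆Q (element-satisfies sP i))

  hasSize-unique : ∀ {p} {P : Pred Carrier p} {k l} → HasSize K P k → HasSize K P l → k ≡ l
  hasSize-unique s t = ≤-antisym (hasSize-mono id s t) (hasSize-mono id t s)

  hasSize-insert : ∀ {p q} {P : Pred Carrier p} {Q : Pred Carrier q} {k} y →
                   (∀ {x} → P x → Q x) → Q y → (∀ {x} → P x → ¬ x ≈ y) →
                   (∀ {x} → Q x → P x ⊎ x ≈ y) → HasSize K P k → HasSize K Q (suc k)
  hasSize-insert {Q = Q} {k} y P⊆Q Qy y∉P Q⊆ s = hasSize f Qf inj surj
    where
    f : Fin (suc k) → Carrier
    f zero    = y
    f (suc i) = element s i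
    Qf : ∀ i → Q (f i)
    Qf zero    = Qy
    Qf (suc i) = P⊆Q (element-satisfies s i)
    inj : ∀ {i j} → f i ≈ f j → i ≡ j
    inj {zero}  {zero}  _ = refl
    inj {zero}  {suc j} e = contradiction (Eq.sym e) (y∉P (element-satisfies s j))
    inj {suc i} {zero}  e = contradiction e (y∉P (element-satisfies s i))
    inj {suc i} {suc j} e = cong suc (element-injective s e)
    surj : ∀ {x} → Q x → ∃[ i ] f i ≈ x
    surj qx with Q⊆ qx
    ... | inj₁ px = let i , e = element-surjective s px in suc i , e
    ... | inj₂ e  = zero , Eq.sym e

  hasSize-resp : ∀ {p q} {P : Pred Carrier p} {Q : Pred Carrier q} {k} →
                 (∀ {x} → P x → Q x) → (∀ {x} → Q x → P x) → HasSize K P k → HasSize K Q k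
  hasSize-resp P⊆Q Q⊆P s = hasSize (element s) (P⊆Q ∘ element-satisfies s)
    (element-injective s) (element-surjective s ∘ Q⊆P)

  hasSize-family : ∀ {n} (s : Fin n → Carrier) → (∀ {i j} → s i ≈ s j → i ≡ j) →
                   ∀ X → HasSize K (λ x → ∃[ i ] i ∈ X × s i ≈ x) ∣ X ∣
  hasSize-family {n} s inj = ∪⁅⁆-induction (λ X → HasSize K (λ x → ∃[ i ] i ∈ X × s i ≈ x) ∣ X ∣)
    (subst (HasSize K _) (sym (∣⊥∣≡0 n))
      (hasSize (λ ()) (λ ()) (λ {}) λ { (i , i∈ , _) → contradiction i∈ ∉⊥ }))
    λ X {y} y∉X s-X → subst (HasSize K _) (sym (∣p∪⁅x⁆∣≡1+∣p∣ X y∉X))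
      (hasSize-insert (s y)
        (λ { (i , i∈ , e) → i , p⊆p∪q ⁅ y ⁆ i∈ , e })
        (y , x∈p∪⁅x⁆ X y , Eq.refl)
        (λ { (i , i∈ , e) e′ → y∉X (subst (_∈ X) (inj (Eq.trans e e′)) i∈) })
        (λ { (i , i∈ , e) → map₁ (λ i∈X → i , i∈X , e)
               (map₂ (λ i∈y → Eq.trans (Eq.sym e)
                  (Eq.reflexive (cong s (x∈⁅y⁆⇒x≡y y i∈y)))) (x∈p∪q⁻ X ⁅ y ⁆ i∈)) })
        s-X)

-- Joins of sets of atoms

module AtomJoins {c ℓ₁ ℓ₂} (K : Poset c ℓ₁ ℓ₂) {n} (at : Fin n → Poset.Carrier K) where

  open Poset K using (Carrier; _≈_; module Eq; reflexive)
    renaming (_≤_ to _⊑_; antisym to ⊑-antisym; trans to ⊑-trans; refl to ⊑-refl)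

  Bounds : Subset n → Carrier → Set ℓ₂
  Bounds X u = ∀ {i} → i ∈ X → at i ⊑ u

  -- Equivalent to `IsJoin` on `AtomSet X`, but quantified over indices, which avoids the universe
  -- lifting.
  IsLub : Subset n → Carrier → Set (c ⊔ ℓ₂)
  IsLub X j = Bounds X j × (∀ u → Bounds X u → j ⊑ u)

  lub-mono : ∀ {X Y j k} → X ⊆ Y → IsLub X j → IsLub Y k → j ⊑ k
  lub-mono X⊆Y (_ , j-min) (Y⊑k , _) = j-min _ (Y⊑k ∘ X⊆Y)

  lub-unique : ∀ {X j k} → IsLub X j → IsLub X k → j ≈ k
  lub-unique j-lub k-lub = ⊑-antisym (lub-mono id j-lub k-lub) (lub-mono id k-lub j-lub)

  lub-∪ : ∀ {X j i k} → IsLub X j → j ⊑ k → at i ⊑ k →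
          (∀ v → j ⊑ v → at i ⊑ v → k ⊑ v) → IsLub (X ∪ ⁅ i ⁆) k
  lub-∪ {X} {j} {i} {k} (X⊑j , j-min) j⊑k i⊑k k-min =
    (λ x∈ → [ (λ x∈X → ⊑-trans (X⊑j x∈X) j⊑k)
            , (λ x∈i → subst (λ z → at z ⊑ k) (sym (x∈⁅y⁆⇒x≡y i x∈i)) i⊑k)
            ]′ (x∈p∪q⁻ X ⁅ i ⁆ x∈)) ,
    λ u X∪i⊑u → k-min u (j-min u (X∪i⊑u ∘ p⊆p∪q ⁅ i ⁆)) (X∪i⊑u (x∈p∪⁅x⁆ X i))

  -- Unfolds to the same type as `atomSet` in `IsGeometricSemilattice`, so that results about it
  -- apply to (G2) directly.
  AtomSet : Subset n → Pred Carrier (c ⊔ ℓ₁ ⊔ ℓ₂)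
  AtomSet X x = Lift (c ⊔ ℓ₁ ⊔ ℓ₂) (∃[ i ] i ∈ X × at i ≈ x)

  isJoin⇒isLub : ∀ {X j} → IsJoin K (AtomSet X) j → IsLub X j
  isJoin⇒isLub (ub , least) =
    (λ i∈X → ub (lift (_ , i∈X , Eq.refl))) ,
    λ u X⊑u → least u λ { (lift (i , i∈X , e)) → ⊑-trans (reflexive (Eq.sym e)) (X⊑u i∈X) }

  isLub⇒isJoin : ∀ {X j} → IsLub X j → IsJoin K (AtomSet X) j
  isLub⇒isJoin (ub , least) =
    (λ { (lift (i , i∈X , e)) → ⊑-trans (reflexive (Eq.sym e)) (ub i∈X) }) ,
    λ u X⊑u → least u λ i∈X → X⊑u (lift (_ , i∈X , Eq.refl))

  hasSize-AtomSet : (∀ {i j} → at i ≈ at j → i ≡ j) → ∀ X → HasSize K (AtomSet X) ∣ X ∣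
  hasSize-AtomSet inj X = hasSize-resp K lift lower (hasSize-family K at inj X)

-- What geometric semilattices and posets of flats have in common; cover is the case of
-- semimodularity in which one of the two elements is an atom.
record AtomicRank {c ℓ₁ ℓ₂} (K : Poset c ℓ₁ ℓ₂) (n : ℕ) : Set (c ⊔ ℓ₁ ⊔ ℓ₂) where
  open Poset K using (Carrier; _≈_) renaming (_≤_ to _⊑_)
  field
    0̂             : Carrier
    minimum       : ∀ x → 0̂ ⊑ x
    r             : Carrier → ℕ
    r-0̂           : r 0̂ ≡ 0
    r-mono        : ∀ {x y} → x ⊑ y → r x ≤ r y
    r-reflect     : ∀ {x y} → x ⊑ y → r y ≤ r x → y ⊑ x
    at            : Fin n → Carrier
    r-at          : ∀ i → r (at i) ≡ 1
    at-injective  : ∀ {i j} → at i ≈ at j → i ≡ j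
    at-surjective : ∀ {x} → r x ≡ 1 → ∃[ i ] at i ≈ x
    atomistic     : ∀ {x y} → (∀ i → at i ⊑ x → at i ⊑ y) → x ⊑ y
    cover         : ∀ {x u i} → x ⊑ u → at i ⊑ u → ¬ at i ⊑ x →
                    ∃[ y ] x ⊑ y × at i ⊑ y × (∀ v → x ⊑ v → at i ⊑ v → y ⊑ v) ×
                           r y ≡ suc (r x)
  open AtomJoins K at public

  -- The form taken by (CR2) on sets of atoms.
  Exchange : Set (c ⊔ ℓ₂)
  Exchange = ∀ {X x y} → IsLub X y → r x < r y →
             ∃[ i ] i ∈ X × ¬ at i ⊑ x × ∃[ u ] x ⊑ u × at i ⊑ u

-- Consequences of an atomic rank: submodularity, meets, chains, independence

module AtomicRankProperties {c ℓ₁ ℓ₂} (em : ExcludedMiddle (c ⊔ ℓ₁ ⊔ ℓ₂)) (K : Poset c ℓ₁ ℓ₂)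
                            {n} (R : AtomicRank K n) where

  private
    ℓ : Level
    ℓ = c ⊔ ℓ₁ ⊔ ℓ₂
    em₂ : ExcludedMiddle ℓ₂
    em₂ = lower-em ℓ em

  open Poset K using (Carrier; _≈_; module Eq; reflexive)
    renaming (_≤_ to _⊑_; antisym to ⊑-antisym; trans to ⊑-trans; refl to ⊑-refl)
  open AtomicRank R

  r-cong : ∀ {x y} → x ≈ y → r x ≡ r y
  r-cong e = ≤-antisym (r-mono (reflexive e)) (r-mono (reflexive (Eq.sym e)))

  separating : ∀ {x y} → ¬ x ⊑ y → ∃[ i ] at i ⊑ x × ¬ at i ⊑ y
  separating {x} {y} x⋢y = decidable-stable (lower-em ℓ em) λ none →
    x⋢y (atomistic λ i i⊑x → decidable-stable em₂ λ i⋢y → none (i , i⊑x , i⋢y))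

  -- The elements of `X` are inserted one at a time. An atom below the current join changes nothing;
  -- any other atom joins the basis, and by `cover` rank and cardinality both grow by one.
  join-basis : ∀ {u} X → Bounds X u →
               ∃[ j ] IsLub X j × ∃[ J ] J ⊆ X × IsLub J j × r j ≡ ∣ J ∣
  join-basis {u} = ∪⁅⁆-induction _
    (λ _ → 0̂ , lub-⊥ , ⊥ , id , lub-⊥ , trans r-0̂ (sym (∣⊥∣≡0 n)))
    step
    where
    lub-⊥ : IsLub ⊥ 0̂
    lub-⊥ = (λ i∈ → contradiction i∈ ∉⊥) , λ u _ → minimum u
    step : ∀ X {x} → x ∉ X →
      (Bounds X u → ∃[ j ] IsLub X j × ∃[ J ] J ⊆ X × IsLub J j × r j ≡ ∣ J ∣) →
      Bounds (X ∪ ⁅ x ⁆) u →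
      ∃[ j ] IsLub (X ∪ ⁅ x ⁆) j × ∃[ J ] J ⊆ X ∪ ⁅ x ⁆ × IsLub J j × r j ≡ ∣ J ∣
    step X {x} x∉X rec X∪x⊑u with rec (X∪x⊑u ∘ p⊆p∪q ⁅ x ⁆)
    ... | j , lubX , J , J⊆X , lubJ , rj with em₂ {at x ⊑ j}
    ... | yes x⊑j =
      j , lub-∪ lubX ⊑-refl x⊑j (λ _ j⊑v _ → j⊑v) , J , p⊆p∪q ⁅ x ⁆ ∘ J⊆X , lubJ , rj
    ... | no x⋢j with cover (proj₂ lubX u (X∪x⊑u ∘ p⊆p∪q ⁅ x ⁆)) (X∪x⊑u (x∈p∪⁅x⁆ X x)) x⋢j
    ... | k , j⊑k , x⊑k , k-min , rk =
      k , lub-∪ lubX j⊑k x⊑k k-min , J ∪ ⁅ x ⁆ ,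
      ∪-lub (p⊆p∪q ⁅ x ⁆ ∘ J⊆X) (q⊆p∪q X ⁅ x ⁆) , lub-∪ lubJ j⊑k x⊑k k-min ,
      trans rk (trans (cong suc rj) (sym (∣p∪⁅x⁆∣≡1+∣p∣ J (x∉X ∘ J⊆X))))

  joins : ∀ {u} X → Bounds X u → ∃ (IsLub X)
  joins X X⊑u = let j , lub , _ = join-basis X X⊑u in j , lub

  r-lub≤ : ∀ {X j} → IsLub X j → r j ≤ ∣ X ∣
  r-lub≤ {X} lub with k , lub′ , J , J⊆X , _ , rk ← join-basis X (proj₁ lub) =
    ≤-trans (≤-reflexive (trans (r-cong (lub-unique lub lub′)) rk)) (p⊆q⇒∣p∣≤∣q∣ J⊆X)

  -- Climb from `m` to `k` by adding atoms below `k`, both to `m` and to `j`. Each step raises `r m`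
  -- by one and `r j` by at most one, and once `k ⊑ m` the join `v` is `j`. Any common lower bound
  -- can serve as `m`.
  submodular : ∀ {j k m v} → m ⊑ j → m ⊑ k → j ⊑ v → k ⊑ v →
               (∀ w → j ⊑ w → k ⊑ w → v ⊑ w) → r v + r m ≤ r j + r k
  -- The recursion is on a bound `d` for the difference of `r k` and `r m`; `r k` is such a bound.
  submodular {j} {k} {m} = go (r k) j m (m≤n+m (r k) (r m))
    where
    go : ∀ d j m {v} → r k ≤ r m + d → m ⊑ j → m ⊑ k → j ⊑ v → k ⊑ v →
         (∀ w → j ⊑ w → k ⊑ w → v ⊑ w) → r v + r m ≤ r j + r k
    go d j m {v} d-bound m⊑j m⊑k j⊑v k⊑v v-min with em₂ {k ⊑ m}
    ... | yes k⊑m = +-mono-≤ (r-mono (v-min j ⊑-refl (⊑-trans k⊑m m⊑j))) (r-mono m⊑k)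
    go zero j m d-bound m⊑j m⊑k j⊑v k⊑v v-min | no k⋢m =
      contradiction (r-reflect m⊑k (≤-trans d-bound (≤-reflexive (+-identityʳ (r m))))) k⋢m
    go (suc d) j m {v} d-bound m⊑j m⊑k j⊑v k⊑v v-min | no k⋢m
      with i , i⊑k , i⋢m ← separating k⋢m
      with m′ , m⊑m′ , i⊑m′ , m′-min , rm′ ← cover m⊑k i⊑k i⋢m
      with em₂ {at i ⊑ j}
    -- Here only `m` grows, and `j` stays.
    ... | yes i⊑j = ≤-trans (+-monoʳ-≤ (r v) (r-mono m⊑m′))
      (go d j m′ d-bound′ (m′-min j m⊑j i⊑j) (m′-min k m⊑k i⊑k) j⊑v k⊑v v-min)
      where
      d-bound′ : r k ≤ r m′ + d
      d-bound′ = ≤-trans d-bound (≤-reflexive (trans (+-suc (r m) d) (cong (_+ d) (sym rm′))))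
    ... | no i⋢j with j′ , j⊑j′ , i⊑j′ , j′-min , rj′ ← cover j⊑v (⊑-trans i⊑k k⊑v) i⋢j =
      -- Here both `m` and `j` grow, so each side of the inductive inequality is larger by one.
      s≤s⁻¹ (≤-trans (≤-reflexive (trans (sym (+-suc (r v) (r m))) (cong (r v +_) (sym rm′))))
        (≤-trans
          (go d j′ m′ d-bound′ (m′-min j′ (⊑-trans m⊑j j⊑j′) i⊑j′) (m′-min k m⊑k i⊑k)
            (j′-min v j⊑v (⊑-trans i⊑k k⊑v)) k⊑v (λ w j′⊑w → v-min w (⊑-trans j⊑j′ j′⊑w)))
          (≤-reflexive (cong (_+ r k) rj′))))
      where
      d-bound′ : r k ≤ r m′ + d
      d-bound′ = ≤-trans d-bound (≤-reflexive (trans (+-suc (r m) d) (cong (_+ d) (sym rm′))))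

  -- The meet is the join of the atoms below all members of `P`; this set of atoms is bounded by any
  -- one member.
  meets : ∀ (P : Pred Carrier ℓ) → ∃ P → ∃ (IsMeet K P)
  meets P (p , Pp) = m , (λ Px → m-min _ (λ i∈ → ∈⟦⟧⁻ common? i∈ Px)) ,
    λ l l⊑P → atomistic λ i i⊑l → m-bound (∈⟦⟧⁺ common? (λ Px → ⊑-trans i⊑l (l⊑P Px)))
    where
    common? : Decidable (λ i → ∀ {x} → P x → at i ⊑ x)
    common? i = em
    m-join : ∃ (IsLub ⟦ common? ⟧)
    m-join = joins ⟦ common? ⟧ (λ i∈ → ∈⟦⟧⁻ common? i∈ Pp)
    m = proj₁ m-join
    m-bound = proj₁ (proj₂ m-join)
    m-min = proj₂ (proj₂ m-join)

  isMeetSemilattice : IsMeetSemilattice K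
  isMeetSemilattice = record { meets = meets ; 0̂ = 0̂ ; minimum = minimum }

  -- If a rank were missing, a further element would fit between the last member of smaller
  -- rank and the first member of larger rank.
  maximalChain-ranks : ∀ {x C} → IsMaximalChainFromTo K 0̂ x C →
                       ∀ k → k ≤ r x → ∃[ y ] C y × r y ≡ k
  maximalChain-ranks (chain , _) zero _ = 0̂ , IsChainFromTo.start chain , r-0̂
  maximalChain-ranks {x} {C} max@(chain , maximal) (suc k) k<rx
    with y , Cy , ry ← maximalChain-ranks max k (<⇒≤ k<rx)
    with d , (Cd , k<rd) , d-min ← minimise em r (λ z → C z × k < r z)
                                     (IsChainFromTo.end chain , k<rx)
    with y⊑d ← [ id , (λ d⊑y → r-reflect d⊑y (≤-trans (≤-reflexive ry) (<⇒≤ k<rd))) ]′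
                 (IsChainFromTo.total chain Cy Cd)
    with i , i⊑d , i⋢y ← separating {d} {y}
           (λ d⊑y → <⇒≱ k<rd (≤-trans (r-mono d⊑y) (≤-reflexive ry)))
    with e , y⊑e , i⊑e , e-min , re ← cover y⊑d i⊑d i⋢y =
      e , maximal D D-chain inj₁ (inj₂ (lift Eq.refl)) , trans re (cong suc ry)
    where
    open IsChainFromTo chain
    D : Pred Carrier ℓ
    D z = C z ⊎ Lift ℓ (z ≈ e)
    e⊑d : e ⊑ d
    e⊑d = e-min d y⊑d i⊑d
    comparable : ∀ {z} → C z → z ⊑ e ⊎ e ⊑ z
    comparable {z} Cz with r z ≤? k
    ... | yes rz≤k with total Cz Cy
    ...   | inj₁ z⊑y = inj₁ (⊑-trans z⊑y y⊑e)
    ...   | inj₂ y⊑z = inj₁ (⊑-trans (r-reflect y⊑z (≤-trans rz≤k (≤-reflexive (sym ry)))) y⊑e)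
    comparable {z} Cz | no rz≰k with total Cd Cz
    ...   | inj₁ d⊑z = inj₂ (⊑-trans e⊑d d⊑z)
    ...   | inj₂ z⊑d = inj₂ (⊑-trans e⊑d (r-reflect z⊑d (d-min z (Cz , ≰⇒> rz≰k))))
    D-chain : IsChainFromTo K 0̂ x D
    D-chain = record
      { start   = inj₁ start
      ; end     = inj₁ end
      ; between = λ { (inj₁ Cz) → between Cz
                    ; (inj₂ (lift z≈e)) → minimum _ ,
                        ⊑-trans (⊑-trans (reflexive z≈e) e⊑d) (proj₂ (between Cd)) }
      ; total   = λ
          { (inj₁ Cz) (inj₁ Cw) → total Cz Cw
          ; (inj₁ Cz) (inj₂ (lift w≈e)) →
              map₁ (λ z⊑e → ⊑-trans z⊑e (reflexive (Eq.sym w≈e)))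
                (map₂ (⊑-trans (reflexive w≈e)) (comparable Cz))
          ; (inj₂ (lift z≈e)) (inj₁ Cw) →
              [ (λ w⊑e → inj₂ (⊑-trans w⊑e (reflexive (Eq.sym z≈e))))
              , (λ e⊑w → inj₁ (⊑-trans (reflexive z≈e) e⊑w)) ]′ (comparable Cw)
          ; (inj₂ (lift z≈e)) (inj₂ (lift w≈e)) → inj₁ (reflexive (Eq.trans z≈e (Eq.sym w≈e)))
          }
      }

  -- A maximal chain to `x` has a member of every rank from 0 to `r x`, and only one of each, since
  -- comparable elements of equal rank coincide.
  isRankFunction : IsRankFunction K 0̂ r
  isRankFunction = record { cong = r-cong ; length = length }
    where
    length : ∀ x C → IsMaximalChainFromTo K 0̂ x C → HasSize K C (suc (r x))
    length x C max@(chain , _) = hasSize K elem (proj₁ ∘ proj₂ ∘ level)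
      (λ {i} {j} e → toℕ-injective
        (trans (sym (proj₂ (proj₂ (level i)))) (trans (r-cong e) (proj₂ (proj₂ (level j))))))
      λ {y} Cy → let i = fromℕ< (s≤s (r-mono (proj₂ (between Cy))))
                     z , Cz , rz = level i
                     rz≡ry = trans rz (toℕ-fromℕ< _)
                 in i , [ (λ z⊑y → ⊑-antisym z⊑y (r-reflect z⊑y (≤-reflexive (sym rz≡ry))))
                        , (λ y⊑z → ⊑-antisym (r-reflect y⊑z (≤-reflexive rz≡ry)) y⊑z)
                        ]′ (total Cz Cy)
      where
      open IsChainFromTo chain
      level : (i : Fin (suc (r x))) → ∃[ y ] C y × r y ≡ toℕ i
      level i = maximalChain-ranks max (toℕ i) (s≤s⁻¹ (toℕ<n i))
      elem : Fin (suc (r x)) → Carrier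
      elem = proj₁ ∘ level

  G1 : ∀ x → ∃[ A ] (∀ {a} → A a → IsAtom K r a) × IsJoin K A x
  G1 x = A , proj₁ ∘ lower , proj₂ ∘ lower ,
    λ u A⊑u → atomistic λ i i⊑x → A⊑u (lift (r-at i , i⊑x))
    where
    A : Pred Carrier ℓ
    A a = Lift ℓ (r a ≡ 1 × a ⊑ x)

  Indep : Subset n → Set (c ⊔ ℓ₂)
  Indep X = ∃[ j ] IsLub X j × r j ≡ ∣ X ∣

  indep⇒independent : ∀ {X} → Indep X → Independent K r (AtomSet X)
  indep⇒independent {X} (j , lub , rj) = j , isLub⇒isJoin lub ,
    subst (HasSize K (AtomSet X)) (sym rj) (hasSize-AtomSet at-injective X)

  independent⇒indep : ∀ {X} → Independent K r (AtomSet X) → Indep X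
  independent⇒indep {X} (j , join , size) = j , isJoin⇒isLub join ,
    hasSize-unique K size (hasSize-AtomSet at-injective X)

  -- Submodularity for the joins of `X` and `Y ─ X`, with `0̂` as common lower bound: as `Y ─ X`
  -- contributes at most its cardinality, `X` must contribute all of its own.
  indep-⊆ : ∀ {X Y} → X ⊆ Y → Indep Y → Indep X
  indep-⊆ {X} {Y} X⊆Y (k , lubY , rk)
    with j , lubX ← joins X (proj₁ lubY ∘ X⊆Y)
    with l , lubZ ← joins (Y ─ X) (proj₁ lubY ∘ p─q⊆p Y X) =
    j , lubX , ≤-antisym (r-lub≤ lubX)
      (+-cancelˡ-≤ ∣ Y ─ X ∣ ∣ X ∣ (r j) (begin
        ∣ Y ─ X ∣ + ∣ X ∣  ≡⟨ p⊆q⇒∣q─p∣+∣p∣≡∣q∣ X⊆Y ⟩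
        ∣ Y ∣              ≡⟨ rk ⟨
        r k                ≤⟨ m≤m+n (r k) (r 0̂) ⟩
        r k + r 0̂          ≤⟨ submodular (minimum j) (minimum l) (lub-mono X⊆Y lubX lubY)
                                (lub-mono (p─q⊆p Y X) lubZ lubY) k-min ⟩
        r j + r l          ≤⟨ +-monoʳ-≤ (r j) (r-lub≤ lubZ) ⟩
        r j + ∣ Y ─ X ∣    ≡⟨ +-comm (r j) _ ⟩
        ∣ Y ─ X ∣ + r j    ∎))
    where
    open ≤-Reasoning
    k-min : ∀ w → j ⊑ w → l ⊑ w → k ⊑ w
    k-min w j⊑w l⊑w = proj₂ lubY w λ {i} i∈Y → split i∈Y (i ∈? X)
      where
      split : ∀ {i} → i ∈ Y → Dec (i ∈ X) → at i ⊑ w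
      split i∈Y (yes i∈X) = ⊑-trans (proj₁ lubX i∈X) j⊑w
      split i∈Y (no i∉X)  = ⊑-trans (proj₁ lubZ (x∈p∧x∉q⇒x∈p─q i∈Y i∉X)) l⊑w

  module _ (exchange : Exchange) where

    indep-isMatroid : IsMatroid (λ X → Independent K r (AtomSet X))
    indep-isMatroid = record
      { empty        = indep⇒independent
          (let j , lub , _ = join-basis {0̂} ⊥ (λ i∈ → contradiction i∈ ∉⊥)
           in j , lub , ≤-antisym (r-lub≤ lub) (≤-trans (≤-reflexive (∣⊥∣≡0 n)) z≤n))
      ; hereditary   = λ X⊆Y → indep⇒independent ∘ indep-⊆ X⊆Y ∘ independent⇒indep
      ; augmentation = λ X-ind Y-ind ∣X∣<∣Y∣ →
          augment (independent⇒indep X-ind) (independent⇒indep Y-ind) ∣X∣<∣Y∣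
      }
      where
      -- `exchange` finds an atom of `Y` that is bounded together with the join of `X` and not below
      -- it; `cover` then raises the rank by exactly one.
      augment : ∀ {X Y} → Indep X → Indep Y → ∣ X ∣ < ∣ Y ∣ →
                ∃[ i ] i ∈ Y × i ∉ X × Independent K r (AtomSet (X ∪ ⁅ i ⁆))
      augment {X} {Y} (j , lubX , rj) (k , lubY , rk) ∣X∣<∣Y∣
        with i , i∈Y , i⋢j , u , j⊑u , i⊑u ←
               exchange lubY (subst₂ _<_ (sym rj) (sym rk) ∣X∣<∣Y∣)
        with v , j⊑v , i⊑v , v-min , rv ← cover j⊑u i⊑u i⋢j =
        i , i∈Y , i∉X , indep⇒independent (v , lub-∪ lubX j⊑v i⊑v v-min ,
          trans rv (trans (cong suc rj) (sym (∣p∪⁅x⁆∣≡1+∣p∣ X i∉X))))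
        where
        i∉X : i ∉ X
        i∉X i∈X = i⋢j (proj₁ lubX i∈X)

    isGeometricSemilattice : IsGeometricSemilattice K
    isGeometricSemilattice = record
      { isMeetSemilattice = isMeetSemilattice
      ; r                 = r
      ; isRankFunction    = isRankFunction
      ; G1                = G1
      ; atomCount         = n
      ; atoms             = hasSize K at r-at at-injective at-surjective
      ; G2                = indep-isMatroid
      }

-- Posets of flats

module SemimatroidProperties (em₀ : ExcludedMiddle 0ℓ) {n} (M : Semimatroid n) where

  open Semimatroid M public

  rank-cong : ∀ {X Y} .{fX : Face X} .{fY : Face Y} → X ≡ Y → rank X fX ≡ rank Y fY
  rank-cong refl = refl

  face-⊥ : Face ⊥
  face-⊥ = closed ⊥⊆ (proj₂ nonEmpty)

  rank-⊥ : rank ⊥ face-⊥ ≡ 0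
  rank-⊥ = n≤0⇒n≡0 (≤-trans (R1 ⊥ face-⊥) (≤-reflexive (∣⊥∣≡0 n)))

  rank-⁅⁆≤1 : ∀ {x} (fx : Face ⁅ x ⁆) → rank ⁅ x ⁆ fx ≤ 1
  rank-⁅⁆≤1 {x} fx = ≤-trans (R1 ⁅ x ⁆ fx) (≤-reflexive (∣⁅x⁆∣≡1 x))

  rank-∪⁅⁆≤ : ∀ {X x} (fX : Face X) (fXx : Face (X ∪ ⁅ x ⁆)) →
              rank (X ∪ ⁅ x ⁆) fXx ≤ suc (rank X fX)
  rank-∪⁅⁆≤ {X} {x} fX fXx = begin
    rank (X ∪ ⁅ x ⁆) fXx           ≤⟨ m≤m+n _ _ ⟩
    rank (X ∪ ⁅ x ⁆) fXx + _       ≤⟨ R3 X ⁅ x ⁆ fX fx fXx ⟩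
    rank X fX + rank ⁅ x ⁆ fx      ≤⟨ +-monoʳ-≤ (rank X fX) (rank-⁅⁆≤1 fx) ⟩
    rank X fX + 1                  ≡⟨ +-comm _ 1 ⟩
    suc (rank X fX)                ∎
    where
    open ≤-Reasoning
    fx : Face ⁅ x ⁆
    fx = closed (q⊆p∪q X ⁅ x ⁆) fXx

  -- Since `X ∪ ⁅ x ⁆` has the same rank as its subset `X`, it has the rank of its intersection with
  -- `Y`. So (CR1) makes its union with `Y` a face, and (R3) bounds the rank of that union by the
  -- rank of `Y`.
  closure-mono : ∀ {X Y x} (fX : Face X) (fY : Face Y) → X ⊆ Y → closure X fX x → closure Y fY x
  closure-mono {X} {Y} {x} fX fY X⊆Y (fXx , eq) =
    fYx , ≤-antisym upper (R2 Y (Y ∪ ⁅ x ⁆) fY fYx (p⊆p∪q ⁅ x ⁆))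
    where
    Xx : Subset n
    Xx = X ∪ ⁅ x ⁆
    f∩ : Face (Xx ∩ Y)
    f∩ = closed (p∩q⊆p Xx Y) fXx
    rank-Xx≤ : rank Xx fXx ≤ rank (Xx ∩ Y) f∩
    rank-Xx≤ = ≤-trans (≤-reflexive eq)
      (R2 X (Xx ∩ Y) fX f∩ (λ y∈ → x∈p∩q⁺ (p⊆p∪q ⁅ x ⁆ y∈ , X⊆Y y∈)))
    f∪ : Face (Xx ∪ Y)
    f∪ = CR1 Xx Y fXx fY (≤-antisym rank-Xx≤ (R2 (Xx ∩ Y) Xx f∩ fXx (p∩q⊆p Xx Y)))
    Yx⊆ : Y ∪ ⁅ x ⁆ ⊆ Xx ∪ Y
    Yx⊆ = ∪-lub (q⊆p∪q Xx Y) (p⊆p∪q Y ∘ q⊆p∪q X ⁅ x ⁆)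
    fYx : Face (Y ∪ ⁅ x ⁆)
    fYx = closed Yx⊆ f∪
    open ≤-Reasoning
    upper : rank (Y ∪ ⁅ x ⁆) fYx ≤ rank Y fY
    upper = ≤-trans (R2 _ _ fYx f∪ Yx⊆) (+-cancelʳ-≤ (rank Xx fXx) _ _ (begin
      rank (Xx ∪ Y) f∪ + rank Xx fXx        ≤⟨ +-monoʳ-≤ (rank (Xx ∪ Y) f∪) rank-Xx≤ ⟩
      rank (Xx ∪ Y) f∪ + rank (Xx ∩ Y) f∩   ≤⟨ R3 Xx Y fXx fY f∪ ⟩
      rank Xx fXx + rank Y fY               ≡⟨ +-comm (rank Xx fXx) _ ⟩
      rank Y fY + rank Xx fXx               ∎))

  ∈-flat : ∀ {A x} (A-flat : IsFlat A) (fAx : Face (A ∪ ⁅ x ⁆)) →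
           rank (A ∪ ⁅ x ⁆) fAx ≤ rank A (proj₁ A-flat) → x ∈ A
  ∈-flat {A} {x} (fA , cl⊆ , _) fAx le =
    cl⊆ (fAx , ≤-antisym le (R2 A (A ∪ ⁅ x ⁆) fA fAx (p⊆p∪q ⁅ x ⁆)))

  flat-reflect : ∀ {A Y} (A-flat : IsFlat A) (fY : Face Y) → A ⊆ Y →
                 rank Y fY ≤ rank A (proj₁ A-flat) → Y ⊆ A
  flat-reflect {A} {Y} A-flat fY A⊆Y le {y} y∈Y =
    ∈-flat A-flat (closed Ay⊆Y fY) (≤-trans (R2 _ _ (closed Ay⊆Y fY) fY Ay⊆Y) le)
    where
    Ay⊆Y : A ∪ ⁅ y ⁆ ⊆ Y
    Ay⊆Y = ∪-lub A⊆Y (⁅⁆⊆ y∈Y)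

  rank-flat-∪⁅⁆ : ∀ {A x} (A-flat : IsFlat A) (fAx : Face (A ∪ ⁅ x ⁆)) → x ∉ A →
                  rank (A ∪ ⁅ x ⁆) fAx ≡ suc (rank A (proj₁ A-flat))
  rank-flat-∪⁅⁆ A-flat fAx x∉A =
    ≤-antisym (rank-∪⁅⁆≤ (proj₁ A-flat) fAx) (≰⇒> (x∉A ∘ ∈-flat A-flat fAx))

  -- A loop lies in the closure of `⊥`, hence in every flat.
  rank-nonloop : ∀ {A x} → IsFlat A → (fx : Face ⁅ x ⁆) → x ∉ A → rank ⁅ x ⁆ fx ≡ 1
  rank-nonloop {A} {x} (fA , cl⊆ , _) fx x∉A = ≤-antisym (rank-⁅⁆≤1 fx) (n≢0⇒n>0 λ loop →
    x∉A (cl⊆ (closure-mono face-⊥ fA ⊥⊆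
      (subst Face (sym (∪-identityˡ ⁅ x ⁆)) fx ,
       trans (rank-cong (∪-identityˡ ⁅ x ⁆)) (trans loop (sym rank-⊥))))))

  abstract
    -- A largest face among those that contain `X`, have its rank and lie in every flat around `X`.
    -- It is closed, because a further element of its closure could be added without losing these
    -- properties.
    hull : ∀ {X} (fX : Face X) →
           ∃[ F ] Σ[ F-flat ∈ IsFlat F ] X ⊆ F × rank F (proj₁ F-flat) ≡ rank X fX ×
           (∀ {G} → IsFlat G → X ⊆ G → F ⊆ G)
    hull {X} fX with minimise em₀ (λ Y → n ∸ ∣ Y ∣)
        (λ Y → Σ[ fY ∈ Face Y ] X ⊆ Y × rank Y fY ≡ rank X fX × (∀ {G} → IsFlat G → X ⊆ G → Y ⊆ G))
        (fX , id , refl , λ _ → id)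
    ... | F , (fF , X⊆F , eq , F-min) , F-max = F , (fF , cl⊆F , F⊆cl) , X⊆F , eq , F-min
      where
      cl⊆F : ∀ {x} → closure F fF x → x ∈ F
      cl⊆F {x} x∈cl@(fFx , eq′) = decidable-stable (x ∈? F) λ x∉F →
        <⇒≱ (∸-monoʳ-< (≤-reflexive (sym (∣p∪⁅x⁆∣≡1+∣p∣ F x∉F))) (∣p∣≤n (F ∪ ⁅ x ⁆)))
          (F-max (F ∪ ⁅ x ⁆) (fFx , p⊆p∪q ⁅ x ⁆ ∘ X⊆F , trans eq′ eq ,
            λ G-flat X⊆G → ∪-lub (F-min G-flat X⊆G)
              (⁅⁆⊆ (proj₁ (proj₂ G-flat)
                (closure-mono fF (proj₁ G-flat) (F-min G-flat X⊆G) x∈cl)))))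
      F⊆cl : ∀ {x} → x ∈ F → closure F fF x
      F⊆cl {x} x∈F = subst Face (sym F∪x≡F) fF , rank-cong F∪x≡F
        where
        F∪x≡F : F ∪ ⁅ x ⁆ ≡ F
        F∪x≡F = ⊆-antisym (∪-lub id (⁅⁆⊆ x∈F)) (p⊆p∪q ⁅ x ⁆)

module FlatsIso {c ℓ₁ ℓ₂} (em : ExcludedMiddle (c ⊔ ℓ₁ ⊔ ℓ₂)) (K : Poset c ℓ₁ ℓ₂)
                {n} (M : Semimatroid n) (K≅M : K ≅ₚ flats M) where

  private
    ℓ : Level
    ℓ = c ⊔ ℓ₁ ⊔ ℓ₂
    em₀ : ExcludedMiddle 0ℓ
    em₀ = lower-em ℓ em

  open Poset K using (Carrier; _≈_; module Eq; reflexive)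
    renaming (_≤_ to _⊑_; antisym to ⊑-antisym; trans to ⊑-trans; refl to ⊑-refl)
  open SemimatroidProperties em₀ M public
  private module K≅M = IsOrderIsomorphism (_≅ₚ_.isIsomorphism K≅M)

  φ : Carrier → Subset n
  φ x = proj₁ (_≅ₚ_.to K≅M x)

  φ-flat : ∀ x → IsFlat (φ x)
  φ-flat x = proj₂ (_≅ₚ_.to K≅M x)

  φ-face : ∀ x → Face (φ x)
  φ-face x = proj₁ (φ-flat x)

  φ-mono : ∀ {x y} → x ⊑ y → φ x ⊆ φ y
  φ-mono = K≅M.mono

  φ-cancel : ∀ {x y} → φ x ⊆ φ y → x ⊑ y
  φ-cancel = K≅M.cancel

  φ-surjective : ∀ {A} → IsFlat A → ∃[ x ] φ x ≡ A
  φ-surjective A-flat with x , eq ← K≅M.surjective (_ , A-flat) = x , eq Eq.refl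

  r : Carrier → ℕ
  r x = rank (φ x) (φ-face x)

  r-mono : ∀ {x y} → x ⊑ y → r x ≤ r y
  r-mono {x} {y} x⊑y = R2 (φ x) (φ y) (φ-face x) (φ-face y) (φ-mono x⊑y)

  r-reflect : ∀ {x y} → x ⊑ y → r y ≤ r x → y ⊑ x
  r-reflect {x} {y} x⊑y ry≤rx = φ-cancel (flat-reflect (φ-flat x) (φ-face y) (φ-mono x⊑y) ry≤rx)

  span : ∀ {X} (fX : Face X) →
         ∃[ k ] X ⊆ φ k × r k ≡ rank X fX × (∀ {u} → X ⊆ φ u → k ⊑ u)
  span {X} fX with F , F-flat , X⊆F , eq , F-min ← hull fX
              with k , refl ← φ-surjective F-flat =
    k , X⊆F , eq , λ {u} X⊆u → φ-cancel (F-min (φ-flat u) X⊆u)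

  0̂ : Carrier
  0̂ = proj₁ (span face-⊥)

  r-0̂ : r 0̂ ≡ 0
  r-0̂ = trans (proj₁ (proj₂ (proj₂ (span face-⊥)))) rank-⊥

  minimum : ∀ x → 0̂ ⊑ x
  minimum x = proj₂ (proj₂ (proj₂ (span face-⊥))) ⊥⊆

  private
    NonLoop : Fin n → Set
    NonLoop p = Σ[ fp ∈ Face ⁅ p ⁆ ] rank ⁅ p ⁆ fp ≡ 1

    point′ : ∀ {p} → Dec (Face ⁅ p ⁆) → Carrier
    point′ (yes fp) = proj₁ (span fp)
    point′ (no _)   = 0̂

    -- On non-faces the value 0̂ is junk.
    point : Fin n → Carrier
    point p = point′ (em₀ {Face ⁅ p ⁆})

    point-spec : ∀ {p} (fp : Face ⁅ p ⁆) →
                 p ∈ φ (point p) × r (point p) ≡ rank ⁅ p ⁆ fp × (∀ {u} → p ∈ φ u → point p ⊑ u)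
    point-spec {p} fp = spec em₀
      where
      spec : (d : Dec (Face ⁅ p ⁆)) →
             p ∈ φ (point′ d) × r (point′ d) ≡ rank ⁅ p ⁆ fp × (∀ {u} → p ∈ φ u → point′ d ⊑ u)
      spec (yes fp) with _ , p∈ , eq , least ← span fp = p∈ (x∈⁅x⁆ p) , eq , λ p∈u → least (⁅⁆⊆ p∈u)
      spec (no ¬fp) = contradiction fp ¬fp

    -- One point for each parallel class of nonloops: parallel points span the same atom.
    points = transversal (lower-em ℓ em) em₀ Eq.setoid point NonLoop

  atomCount : ℕ
  atomCount = proj₁ points

  private
    t : Fin atomCount → Fin n
    t = proj₁ (proj₂ points)

    t-nonLoop : ∀ i → NonLoop (t i)
    t-nonLoop = proj₁ (proj₂ (proj₂ points))

  at : Fin atomCount → Carrier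
  at = point ∘ t

  -- The flat `φ y` avoids `p`, so `p` is not a loop, and the chosen representative of its parallel
  -- class spans the same element.
  atom-through : ∀ {p y} → Face ⁅ p ⁆ → p ∉ φ y →
                 ∃[ j ] p ∈ φ (at j) × (∀ {u} → p ∈ φ u → at j ⊑ u)
  atom-through {p} {y} fp p∉y
    with p∈ , _ , least ← point-spec fp
    with j , e ← proj₂ (proj₂ (proj₂ (proj₂ points))) p (fp , rank-nonloop (φ-flat y) fp p∉y) =
    j , φ-mono (reflexive (Eq.sym e)) p∈ , λ p∈u → ⊑-trans (reflexive e) (least p∈u)

  r-at : ∀ i → r (at i) ≡ 1
  r-at i with fp , eq ← t-nonLoop i with _ , eq′ , _ ← point-spec fp = trans eq′ eq

  atomistic : ∀ {x y} → (∀ i → at i ⊑ x → at i ⊑ y) → x ⊑ y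
  atomistic {x} {y} below = φ-cancel λ {p} p∈x → decidable-stable (p ∈? φ y) λ p∉y →
    let j , p∈j , least = atom-through {y = y} (closed (⁅⁆⊆ p∈x) (φ-face x)) p∉y
    in p∉y (φ-mono (below j (least p∈x)) p∈j)

  -- Were `x` none of the listed atoms, none of them would lie below it, by equality of ranks. Then
  -- `x ⊑ 0̂` by `atomistic`, contrary to rank 1.
  at-surjective : ∀ {x} → r x ≡ 1 → ∃[ i ] at i ≈ x
  at-surjective {x} rx = decidable-stable (lower-em ℓ em) λ none →
    contradiction
      (≤-trans (≤-reflexive (sym rx)) (≤-trans (r-mono (atomistic {x} {0̂} λ i i⊑x →
        contradiction (i , ⊑-antisym i⊑x (r-reflect i⊑x (≤-reflexive (trans rx (sym (r-at i))))))
          none)) (≤-reflexive r-0̂)))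
      λ ()

  -- The required element is spanned by the flat of `x` and the point `t i` outside it. Their union
  -- is a face because it lies in the flat of `u`.
  cover : ∀ {x u i} → x ⊑ u → at i ⊑ u → ¬ at i ⊑ x →
          ∃[ y ] x ⊑ y × at i ⊑ y × (∀ v → x ⊑ v → at i ⊑ v → y ⊑ v) × r y ≡ suc (r x)
  cover {x} {u} {i} x⊑u i⊑u i⋢x
    with fp , _ ← t-nonLoop i
    with p∈ , _ , least ← point-spec fp
    with fxp ← closed (∪-lub (φ-mono x⊑u) (⁅⁆⊆ (φ-mono i⊑u p∈))) (φ-face u)
    with y , xp⊆y , eq , y-min ← span fxp =
    y , φ-cancel (xp⊆y ∘ p⊆p∪q ⁅ t i ⁆) , least (xp⊆y (x∈p∪⁅x⁆ (φ x) (t i))) ,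
    (λ v x⊑v i⊑v → y-min (∪-lub (φ-mono x⊑v) (⁅⁆⊆ (φ-mono i⊑v p∈)))) ,
    trans eq (rank-flat-∪⁅⁆ (φ-flat x) fxp (λ p∈x → i⋢x (least p∈x)))

  atomicRank : AtomicRank K atomCount
  atomicRank = record
    { 0̂ = 0̂ ; minimum = minimum ; r = r ; r-0̂ = r-0̂ ; r-mono = r-mono ; r-reflect = r-reflect
    ; at = at ; r-at = r-at ; at-injective = proj₁ (proj₂ (proj₂ (proj₂ points)))
    ; at-surjective = at-surjective ; atomistic = atomistic ; cover = cover
    }

  -- (CR2) is applied to the union of the flats of the given atoms.
  exchange : AtomicRank.Exchange atomicRank
  exchange {X} {x} {y} (X⊑y , y-min) rx<ry =
    let k , Y⊆k , eq , _ = span fY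
        y⊑k = y-min k λ {i} i∈X → φ-cancel λ p∈i → Y⊆k (∈⟦⟧⁺ Y? (i , i∈X , p∈i))
        p , p∈Y , p∉x , fxp = CR2 (φ x) Y (φ-face x) fY
          (<-≤-trans rx<ry (≤-trans (r-mono y⊑k) (≤-reflexive eq)))
        u , xp⊆u , _ = span fxp
        i , i∈X , p∈i = ∈⟦⟧⁻ Y? p∈Y
        -- (CR2) concerns the point `p` of the flat of `at i`, not the whole atom. The atom `at j`
        -- through `p` lies below `at i` and has the same rank, so `at i ⊑ at j ⊑ u`.
        j , p∈j , least = atom-through {y = x} (closed (q⊆p∪q (φ x) ⁅ p ⁆) fxp) p∉x
    in i , i∈X , (λ i⊑x → p∉x (φ-mono i⊑x p∈i)) , u , φ-cancel (xp⊆u ∘ p⊆p∪q ⁅ p ⁆) ,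
       ⊑-trans (r-reflect (least p∈i) (≤-reflexive (trans (r-at i) (sym (r-at j)))))
         (least (xp⊆u (x∈p∪⁅x⁆ (φ x) p)))
    where
    Y? : Decidable (λ p → ∃[ i ] i ∈ X × p ∈ φ (at i))
    Y? p = em₀
    Y : Subset n
    Y = ⟦ Y? ⟧
    fY : Face Y
    fY = closed (λ p∈ → let i , i∈X , p∈i = ∈⟦⟧⁻ Y? p∈ in φ-mono (X⊑y i∈X) p∈i) (φ-face y)

-- The simple semimatroid of bounded sets of atoms

module ToSemimatroid {c ℓ₁ ℓ₂} (em : ExcludedMiddle (c ⊔ ℓ₁ ⊔ ℓ₂)) (K : Poset c ℓ₁ ℓ₂)
                     {n} (R : AtomicRank K n) (exchange : AtomicRank.Exchange R) where

  private
    ℓ : Level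
    ℓ = c ⊔ ℓ₁ ⊔ ℓ₂

  open Poset K using (Carrier; _≈_; module Eq; reflexive)
    renaming (_≤_ to _⊑_; antisym to ⊑-antisym; trans to ⊑-trans; refl to ⊑-refl)
  open AtomicRank R
  open AtomicRankProperties em K R

  private
    bounded? : ∀ X → Dec (∃ (Bounds X))
    bounded? X = lower-em ℓ em

    -- Boundedness lives in the universe of `K`; `True` of its decision brings it down to `Set`.
    Face : Subset n → Set
    Face X = True (bounded? X)

    face⁺ : ∀ {X u} → Bounds X u → Face X
    face⁺ X⊑u = fromWitness (_ , λ {i} → X⊑u {i})

    -- Computed from the decision, since `rank` receives the proof of `Face X` only irrelevantly.
    join′ : ∀ {X} → Dec (∃ (Bounds X)) → Carrier
    join′ {X} (yes (_ , X⊑u)) = proj₁ (joins X X⊑u)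
    join′ (no _)              = 0̂

    -- On unbounded sets the value 0̂ is junk.
    join : Subset n → Carrier
    join X = join′ (bounded? X)

    join-lub : ∀ {X} → Face X → IsLub X (join X)
    join-lub {X} fX = lub (bounded? X) (toWitness fX)
      where
      lub : (d : Dec (∃ (Bounds X))) → ∃ (Bounds X) → IsLub X (join′ d)
      lub (yes (_ , X⊑u)) _ = proj₂ (joins X X⊑u)
      lub (no unbounded)  b = contradiction b unbounded

    join-≈ : ∀ {X j} → IsLub X j → join X ≈ j
    join-≈ lub = lub-unique (join-lub (face⁺ (proj₁ lub))) lub

    bounds-∪ : ∀ {X Y u} → Bounds X u → Bounds Y u → Bounds (X ∪ Y) u
    bounds-∪ {X} {Y} X⊑u Y⊑u i∈ = [ X⊑u , Y⊑u ]′ (x∈p∪q⁻ X Y i∈)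

    bounds-⁅⁆ : ∀ {i u} → at i ⊑ u → Bounds ⁅ i ⁆ u
    bounds-⁅⁆ {i} {u} i⊑u j∈ = subst (λ j → at j ⊑ u) (sym (x∈⁅y⁆⇒x≡y i j∈)) i⊑u

    lub-⁅⁆ : ∀ i → IsLub ⁅ i ⁆ (at i)
    lub-⁅⁆ i = bounds-⁅⁆ ⊑-refl , λ u i⊑u → i⊑u (x∈⁅x⁆ i)

  semimatroid : Semimatroid n
  semimatroid = record
    { complex  = record
      { Face   = Face
      ; closed = λ X⊆Y fY → face⁺ (proj₁ (join-lub fY) ∘ X⊆Y)
      }
    ; nonEmpty = ⊥ , face⁺ {u = 0̂} (λ i∈ → contradiction i∈ ∉⊥)
    ; rank     = λ X _ → r (join X)
    ; R1       = λ X fX → r-lub≤ (join-lub fX)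
    ; R2       = λ X Y fX fY X⊆Y → r-mono (lub-mono X⊆Y (join-lub fX) (join-lub fY))
    ; R3       = λ X Y fX fY fXY →
        let lubX = join-lub fX ; lubY = join-lub fY ; lub∪ = join-lub fXY
            lub∩ = join-lub (face⁺ (proj₁ lubX ∘ p∩q⊆p X Y))
        in submodular (lub-mono (p∩q⊆p X Y) lub∩ lubX) (lub-mono (p∩q⊆q X Y) lub∩ lubY)
             (lub-mono (p⊆p∪q Y) lubX lub∪) (lub-mono (q⊆p∪q X Y) lubY lub∪)
             λ w X⊑w Y⊑w → proj₂ lub∪ w (bounds-∪ (λ i∈ → ⊑-trans (proj₁ lubX i∈) X⊑w)
                                                   (λ i∈ → ⊑-trans (proj₁ lubY i∈) Y⊑w))
    -- Equal ranks put the join of `X` below that of `X ∩ Y`, hence below that of `Y`, which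
    -- therefore bounds `X ∪ Y`.
    ; CR1      = λ X Y fX fY eq →
        let lubX = join-lub fX ; lubY = join-lub fY
            lub∩ = join-lub (face⁺ (proj₁ lubX ∘ p∩q⊆p X Y))
            X⊑∩ = r-reflect (lub-mono (p∩q⊆p X Y) lub∩ lubX) (≤-reflexive eq)
            X⊑Y = ⊑-trans X⊑∩ (lub-mono (p∩q⊆q X Y) lub∩ lubY)
        in face⁺ (bounds-∪ (λ i∈ → ⊑-trans (proj₁ lubX i∈) X⊑Y) (proj₁ lubY))
    ; CR2      = λ X Y fX fY lt →
        let i , i∈Y , i⋢X , u , X⊑u , i⊑u = exchange (join-lub fY) lt
        in i , i∈Y , i⋢X ∘ proj₁ (join-lub fX) ,
           face⁺ (bounds-∪ (λ j∈ → ⊑-trans (proj₁ (join-lub fX) j∈) X⊑u) (bounds-⁅⁆ i⊑u))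
    }

  isSimple : IsSimple semimatroid
  isSimple =
    (λ i → face⁺ (bounds-⁅⁆ {i} ⊑-refl) , trans (r-cong (join-≈ (lub-⁅⁆ i))) (r-at i)) ,
    λ i j i≢j fij →
      let ij⊑ = proj₁ (join-lub fij)
          k , i⊑k , j⊑k , k-min , rk = cover
            (ij⊑ (p⊆p∪q ⁅ j ⁆ (x∈⁅x⁆ i))) (ij⊑ (x∈p∪⁅x⁆ ⁅ i ⁆ j))
            λ j⊑i → i≢j (at-injective (⊑-antisym
              (r-reflect j⊑i (≤-reflexive (trans (r-at i) (sym (r-at j))))) j⊑i))
      in trans (r-cong (join-≈ (lub-∪ (lub-⁅⁆ i) i⊑k j⊑k k-min)))
           (trans rk (cong suc (r-at i)))

  private
    module S = Semimatroid semimatroid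

    below? : ∀ x → Decidable (λ i → at i ⊑ x)
    below? x i = lower-em ℓ em

    below : Carrier → Subset n
    below x = ⟦ below? x ⟧

    lub-below : ∀ x → IsLub (below x) x
    lub-below x = ∈⟦⟧⁻ (below? x) ,
      λ u x⊑u → atomistic λ i i⊑x → x⊑u (∈⟦⟧⁺ (below? x) i⊑x)

    -- If adding `i` keeps the rank of the join, it keeps the join, which is `x`; so `at i ⊑ x`.
    below-flat : ∀ x → S.IsFlat (below x)
    below-flat x = face⁺ (proj₁ (lub-below x)) ,
      (λ {i} (f , eq) → ∈⟦⟧⁺ (below? x) (⊑-trans (proj₁ (join-lub f) (x∈p∪⁅x⁆ (below x) i))
        (⊑-trans (r-reflect (lub-mono (p⊆p∪q ⁅ i ⁆) (join-lub (face⁺ (proj₁ (lub-below x)))) (join-lub f))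
          (≤-reflexive eq)) (reflexive (join-≈ (lub-below x)))))) ,
      λ {i} i∈ → let same = ⊆-antisym (∪-lub id (⁅⁆⊆ i∈)) (p⊆p∪q {p = below x} ⁅ i ⁆)
                 in subst Face (sym same) (face⁺ (proj₁ (lub-below x))) , cong (r ∘ join) same

    below-mono : ∀ {x y} → x ⊑ y → below x ⊆ below y
    below-mono {x} {y} x⊑y i∈ = ∈⟦⟧⁺ (below? y) (⊑-trans (∈⟦⟧⁻ (below? x) i∈) x⊑y)

    below-cancel : ∀ {x y} → below x ⊆ below y → x ⊑ y
    below-cancel {x} {y} x⊆y = atomistic λ i i⊑x → ∈⟦⟧⁻ (below? y) (x⊆y (∈⟦⟧⁺ (below? x) i⊑x))

    -- An atom below the join of `A` leaves the join unchanged, so it is in the closure of `A`.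
    below-join : ∀ {A} → S.IsFlat A → below (join A) ≡ A
    below-join {A} (fA , cl⊆A , _) = ⊆-antisym
      (λ {i} i∈ →
        let fAi = face⁺ (bounds-∪ (proj₁ (join-lub fA)) (bounds-⁅⁆ (∈⟦⟧⁻ (below? (join A)) i∈)))
        in cl⊆A (fAi , ≤-antisym
             (r-mono (proj₂ (join-lub fAi) (join A)
               (bounds-∪ (proj₁ (join-lub fA)) (bounds-⁅⁆ (∈⟦⟧⁻ (below? (join A)) i∈)))))
             (r-mono (lub-mono (p⊆p∪q ⁅ i ⁆) (join-lub fA) (join-lub fAi)))))
      (λ i∈A → ∈⟦⟧⁺ (below? (join A)) (proj₁ (join-lub fA) i∈A))

  below-cong : ∀ {x y} → x ≈ y → below x ≡ below y
  below-cong e = ⊆-antisym (below-mono (reflexive e)) (below-mono (reflexive (Eq.sym e)))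

  K≅flats : K ≅ₚ flats semimatroid
  K≅flats = record
    { to            = λ x → below x , below-flat x
    ; isIsomorphism = record
      { isOrderMonomorphism = record
        { isOrderHomomorphism = record { cong = below-cong ; mono = below-mono }
        ; injective           = λ e → ⊑-antisym (below-cancel (⊆-reflexive e))
                                                (below-cancel (⊆-reflexive (sym e)))
        ; cancel              = below-cancel
        }
      ; surjective          = λ (A , A-flat) → join A , λ z≈ → trans (below-cong z≈) (below-join A-flat)
      }
    }

-- Uniqueness of the simple semimatroid

module _ {c ℓ₁ ℓ₂} (em : ExcludedMiddle (c ⊔ ℓ₁ ⊔ ℓ₂)) (K : Poset c ℓ₁ ℓ₂) where

  open Poset K using (Carrier; _≈_; module Eq; reflexive)
    renaming (_≤_ to _⊑_; antisym to ⊑-antisym; trans to ⊑-trans; refl to ⊑-refl)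

  -- Climbing from 0̂ to x in steps of r-rank 1 increases every other rank at least as much.
  rank-≤ : ∀ {m n} (R : AtomicRank K m) (S : AtomicRank K n) x →
           AtomicRank.r R x ≤ AtomicRank.r S x
  rank-≤ R S x = let y , y⊑x , _ , le = climb (R.r x) ≤-refl in ≤-trans le (S.r-mono y⊑x)
    where
    module R = AtomicRank R
    module S = AtomicRank S
    climb : ∀ k → k ≤ R.r x → ∃[ y ] y ⊑ x × R.r y ≡ k × k ≤ S.r y
    climb zero    _    = R.0̂ , R.minimum x , R.r-0̂ , z≤n
    climb (suc k) k<rx
      with y , y⊑x , ry , k≤sy ← climb k (<⇒≤ k<rx)
      with i , i⊑x , i⋢y ← AtomicRankProperties.separating em K R {x} {y}
             (λ x⊑y → <⇒≱ k<rx (≤-trans (R.r-mono x⊑y) (≤-reflexive ry)))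
      with z , y⊑z , i⊑z , z-min , rz ← R.cover y⊑x i⊑x i⋢y =
      z , z-min x y⊑x i⊑x , trans rz (cong suc ry) ,
      ≤-trans (s≤s k≤sy) (≰⇒> λ sz≤sy → i⋢y (⊑-trans i⊑z (S.r-reflect y⊑z sz≤sy)))

  module SimpleFlats {n} (M : Semimatroid n) (simple : IsSimple M) (K≅M : K ≅ₚ flats M) where

    open FlatsIso em K M K≅M public

    -- In a simple semimatroid a second point raises the rank to 2, so it is not in the closure.
    ⁅⁆-flat : ∀ i → IsFlat ⁅ i ⁆
    ⁅⁆-flat i = proj₁ (proj₁ simple i) ,
      (λ {j} (fij , eq) → decidable-stable (j ∈? ⁅ i ⁆) λ j∉ → contradiction
        (trans (sym (proj₂ simple i j (λ { refl → j∉ (x∈⁅x⁆ i) }) fij))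
               (trans eq (proj₂ (proj₁ simple i))))
        λ ()) ,
      λ {j} j∈ → let same = trans (cong (λ k → ⁅ i ⁆ ∪ ⁅ k ⁆) (x∈⁅y⁆⇒x≡y i j∈)) (∪-idem ⁅ i ⁆)
                 in subst Face (sym same) (proj₁ (proj₁ simple i)) , rank-cong same

    atom : Fin n → Carrier
    atom i = proj₁ (φ-surjective (⁅⁆-flat i))

    φ-atom : ∀ i → φ (atom i) ≡ ⁅ i ⁆
    φ-atom i = proj₂ (φ-surjective (⁅⁆-flat i))

    atom-⊑⁺ : ∀ {i x} → i ∈ φ x → atom i ⊑ x
    atom-⊑⁺ {i} {x} i∈x = φ-cancel (subst (_⊆ φ x) (sym (φ-atom i)) (⁅⁆⊆ i∈x))

    atom-⊑⁻ : ∀ {i x} → atom i ⊑ x → i ∈ φ x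
    atom-⊑⁻ {i} i⊑x = φ-mono i⊑x (subst (i ∈_) (sym (φ-atom i)) (x∈⁅x⁆ i))

    atom-injective : ∀ {i j} → atom i ≈ atom j → i ≡ j
    atom-injective {i} {j} e =
      x∈⁅y⁆⇒x≡y j (subst (i ∈_) (φ-atom j) (atom-⊑⁻ (reflexive e)))

    r-atom : ∀ i → r (atom i) ≡ 1
    r-atom i = trans (rank-cong (φ-atom i)) (proj₂ (proj₁ simple i))

    atom-surjective : ∀ {x} → r x ≡ 1 → ∃[ i ] atom i ≈ x
    atom-surjective {x} rx with nonempty? (φ x)
    ... | yes (i , i∈x) = i , ⊑-antisym (atom-⊑⁺ i∈x)
            (r-reflect (atom-⊑⁺ i∈x) (≤-reflexive (trans rx (sym (r-atom i)))))
    ... | no empty = contradiction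
            (trans (sym rx) (trans (rank-cong {fY = face-⊥} (Empty-unique empty)) rank-⊥)) λ ()

  -- The points of `M` and of `N` both enumerate the atoms of `K`, on which the two ranks agree by
  -- `rank-≤` in both directions; `f` matches equal atoms.
  simple-unique : ∀ {m n} (M : Semimatroid m) (N : Semimatroid n) → IsSimple M → IsSimple N →
                  K ≅ₚ flats M → K ≅ₚ flats N → M ≅ₛ N
  simple-unique M N M-simple N-simple K≅M K≅N = record
    { f         = f
    ; bijective = (λ {i} {j} e → M.atom-injective (Eq.trans (Eq.sym (atom-f i))
                    (Eq.trans (Eq.reflexive (cong N.atom e)) (atom-f j)))) ,
                  λ j → let i , e = M.atom-surjective (trans (r≡ (N.atom j)) (N.r-atom j))
                        in i , λ { refl → N.atom-injective (Eq.trans (atom-f i) e) }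
    ; face⇔     = face⇔
    -- A face has the rank of the element it spans, and `X` and its image span the same element of
    -- `K`.
    ; rank≡     = λ X fX →
        let fY = Equivalence.to (face⇔ X) fX
            k , X⊆k , rk , k-min = M.span fX
            l , Y⊆l , rl , l-min = N.span fY
            k⊑l = k-min (image⊆⁻ Y⊆l)
            l⊑k = l-min (image⊆⁺ X⊆k)
        in trans (sym rk) (trans (≤-antisym (M.r-mono k⊑l) (M.r-mono l⊑k)) (trans (r≡ l) rl))
    }
    where
    module M = SimpleFlats M M-simple K≅M
    module N = SimpleFlats N N-simple K≅N
    r≡ : ∀ x → M.r x ≡ N.r x
    r≡ x = ≤-antisym (rank-≤ M.atomicRank N.atomicRank x) (rank-≤ N.atomicRank M.atomicRank x)
    f-spec : ∀ i → ∃[ j ] N.atom j ≈ M.atom i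
    f-spec i = N.atom-surjective (trans (sym (r≡ (M.atom i))) (M.r-atom i))
    f = proj₁ ∘ f-spec
    atom-f : ∀ i → N.atom (f i) ≈ M.atom i
    atom-f = proj₂ ∘ f-spec
    image⊆⁺ : ∀ {X x} → X ⊆ M.φ x → image f X ⊆ N.φ x
    image⊆⁺ X⊆x j∈ with i , i∈X , refl ← x∈image⁻ f j∈ =
      N.atom-⊑⁻ (⊑-trans (reflexive (atom-f i)) (M.atom-⊑⁺ (X⊆x i∈X)))
    image⊆⁻ : ∀ {X x} → image f X ⊆ N.φ x → X ⊆ M.φ x
    image⊆⁻ Y⊆x {i} i∈X = M.atom-⊑⁻
      (⊑-trans (reflexive (Eq.sym (atom-f i))) (N.atom-⊑⁺ (Y⊆x (x∈image⁺ f i∈X))))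
    -- Faces are exactly the sets contained in a flat, and `f` respects containment in flats.
    face⇔ : ∀ X → M.Face X ⇔ N.Face (image f X)
    face⇔ X = mk⇔
      (λ fX → let k , X⊆k , _ = M.span fX in N.closed (image⊆⁺ X⊆k) (N.φ-face k))
      (λ fY → let k , Y⊆k , _ = N.span fY in M.closed (image⊆⁻ Y⊆k) (M.φ-face k))

-- Geometric semilattices

module FromGeometric {c ℓ₁ ℓ₂} (em : ExcludedMiddle (c ⊔ ℓ₁ ⊔ ℓ₂)) (K : Poset c ℓ₁ ℓ₂)
                     (G : IsGeometricSemilattice K) where

  private
    ℓ : Level
    ℓ = c ⊔ ℓ₁ ⊔ ℓ₂
    em₂ : ExcludedMiddle ℓ₂
    em₂ = lower-em ℓ em

  open Poset K using (Carrier; _≈_; module Eq; reflexive)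
    renaming (_≤_ to _⊑_; antisym to ⊑-antisym; trans to ⊑-trans; refl to ⊑-refl)
  open IsGeometricSemilattice G
  open IsRankFunction isRankFunction renaming (cong to r-cong)
  module G2 = IsMatroid G2

  at : Fin atomCount → Carrier
  at = element K atoms

  r-at : ∀ i → r (at i) ≡ 1
  r-at = element-satisfies K atoms

  at-injective : ∀ {i j} → at i ≈ at j → i ≡ j
  at-injective = element-injective K atoms

  open AtomJoins K at

  Indep : Subset atomCount → Carrier → Set (c ⊔ ℓ₂)
  Indep X j = IsLub X j × r j ≡ ∣ X ∣

  indep⇒independent : ∀ {X j} → Indep X j → Independent K r (AtomSet X)
  indep⇒independent {X} (lub , rj) = _ , isLub⇒isJoin lub ,
    subst (HasSize K (AtomSet X)) (sym rj) (hasSize-AtomSet at-injective X)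

  independent⇒indep : ∀ {X} → Independent K r (AtomSet X) → ∃ (Indep X)
  independent⇒indep {X} (j , join , size) = j , isJoin⇒isLub join ,
    hasSize-unique K size (hasSize-AtomSet at-injective X)

  atomistic : ∀ {x y} → (∀ i → at i ⊑ x → at i ⊑ y) → x ⊑ y
  atomistic {x} {y} below with A , A-atoms , A⊑x , x-min ← G1 x = x-min y λ Aa →
    let i , e = element-surjective K atoms (A-atoms Aa)
    in ⊑-trans (reflexive (Eq.sym e)) (below i (⊑-trans (reflexive e) (A⊑x Aa)))

  separating : ∀ {x y} → ¬ x ⊑ y → ∃[ i ] at i ⊑ x × ¬ at i ⊑ y
  separating x⋢y = decidable-stable (lower-em ℓ em) λ none →
    x⋢y (atomistic λ i i⊑x → decidable-stable em₂ λ i⋢y → none (i , i⊑x , i⋢y))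

  private
    below? : ∀ x → Decidable (λ i → at i ⊑ x)
    below? x i = em₂

    below : Carrier → Subset atomCount
    below x = ⟦ below? x ⟧

  -- A measure for recursion along the order, available before `r` is known to be monotone.
  height : Carrier → ℕ
  height x = ∣ below x ∣

  height-< : ∀ {x y} → x ⊑ y → ¬ y ⊑ x → height x < height y
  height-< {x} {y} x⊑y y⋢x with i , i⊑y , i⋢x ← separating y⋢x = p⊂q⇒∣p∣<∣q∣
    ( (λ j∈ → ∈⟦⟧⁺ (below? y) (⊑-trans (∈⟦⟧⁻ (below? x) j∈) x⊑y))
    , i , ∈⟦⟧⁺ (below? y) i⊑y , i⋢x ∘ ∈⟦⟧⁻ (below? x) )

  -- The covering relation of the poset.
  _⋖_ : Carrier → Carrier → Set (c ⊔ ℓ₂)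
  x ⋖ y = x ⊑ y × ¬ y ⊑ x × (∀ z → x ⊑ z → z ⊑ y → z ⊑ x ⊎ y ⊑ z)

  -- An element of maximal height among those between `x` and `y` that are not above `y`.
  coatom : ∀ {x y} → x ⊑ y → ¬ y ⊑ x → ∃[ w ] x ⊑ w × w ⋖ y
  coatom {x} {y} x⊑y y⋢x
    with w , (x⊑w , w⊑y , y⋢w) , w-max ← minimise (lower-em ℓ em) (λ w → atomCount ∸ height w)
           (λ w → x ⊑ w × w ⊑ y × ¬ y ⊑ w) (⊑-refl , x⊑y , y⋢x) =
    w , x⊑w , (w⊑y , y⋢w , λ z w⊑z z⊑y → between w⊑z z⊑y em₂)
    where
    between : ∀ {z} → w ⊑ z → z ⊑ y → Dec (y ⊑ z) → z ⊑ w ⊎ y ⊑ z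
    between _ _ (yes y⊑z) = inj₂ y⊑z
    between {z} w⊑z z⊑y (no y⋢z) = inj₁ (decidable-stable em₂ λ z⋢w →
      <⇒≱ (∸-monoʳ-< (height-< w⊑z z⋢w) (∣p∣≤n (below z))) (w-max z (⊑-trans x⊑w w⊑z , z⊑y , y⋢z)))

  singleton-maximal : ∀ {x} → x ⊑ 0̂ → IsMaximalChainFromTo K 0̂ x (λ z → Lift ℓ (z ≈ x))
  singleton-maximal {x} x⊑0̂ = record
    { start   = lift (⊑-antisym (minimum x) x⊑0̂)
    ; end     = lift Eq.refl
    ; between = λ (lift z≈x) → minimum _ , reflexive z≈x
    ; total   = λ (lift z≈x) (lift w≈x) → inj₁ (reflexive (Eq.trans z≈x (Eq.sym w≈x)))
    } , λ D chain _ Dz → let _ , z⊑x = IsChainFromTo.between chain Dz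
                         in lift (⊑-antisym z⊑x (⊑-trans x⊑0̂ (minimum _)))

  extend : Pred Carrier ℓ → Carrier → Pred Carrier ℓ
  extend C y z = C z ⊎ Lift ℓ (z ≈ y)

  -- Let `D` be a chain containing the extended one. Its members below `x` are in `C` by maximality;
  -- a member above `x` is `x` or `y`, as `y` covers `x`.
  extend-maximal : ∀ {x y C} → IsMaximalChainFromTo K 0̂ x C → x ⋖ y →
                   IsMaximalChainFromTo K 0̂ y (extend C y)
  extend-maximal {x} {y} {C} (chain , maximal) (x⊑y , y⋢x , adjacent) = record
    { start   = inj₁ start
    ; end     = inj₂ (lift Eq.refl)
    ; between = λ { (inj₁ Cz) → minimum _ , below-y Cz ; (inj₂ (lift z≈y)) → minimum _ , reflexive z≈y }
    ; total   = λ
        { (inj₁ Cz) (inj₁ Cw) → total Cz Cw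
        ; (inj₁ Cz) (inj₂ (lift w≈y)) → inj₁ (⊑-trans (below-y Cz) (reflexive (Eq.sym w≈y)))
        ; (inj₂ (lift z≈y)) (inj₁ Cw) → inj₂ (⊑-trans (below-y Cw) (reflexive (Eq.sym z≈y)))
        ; (inj₂ (lift z≈y)) (inj₂ (lift w≈y)) → inj₁ (reflexive (Eq.trans z≈y (Eq.sym w≈y)))
        }
    } , λ D D-chain C∪y⊆D Dz → D⊆ D D-chain C∪y⊆D Dz
    where
    open IsChainFromTo chain
    below-y : ∀ {z} → C z → z ⊑ y
    below-y Cz = ⊑-trans (proj₂ (between Cz)) x⊑y
    module _ (D : Pred Carrier ℓ) (D-chain : IsChainFromTo K 0̂ y D)
             (C∪y⊆D : ∀ {z} → extend C y z → D z) where
      module D = IsChainFromTo D-chain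
      D-below-x : IsChainFromTo K 0̂ x (λ z → D z × Lift ℓ (z ⊑ x))
      D-below-x = record
        { start   = D.start , lift (minimum x)
        ; end     = C∪y⊆D (inj₁ end) , lift ⊑-refl
        ; between = λ (Dz , lift z⊑x) → minimum _ , z⊑x
        ; total   = λ (Dz , _) (Dw , _) → D.total Dz Dw
        }
      in-C : ∀ {z} → D z → z ⊑ x → extend C y z
      in-C Dz z⊑x = inj₁ (maximal _ D-below-x
        (λ Cw → C∪y⊆D (inj₁ Cw) , lift (proj₂ (between Cw))) (Dz , lift z⊑x))
      D⊆ : ∀ {z} → D z → extend C y z
      D⊆ Dz with D.total Dz (C∪y⊆D (inj₁ end))
      ... | inj₁ z⊑x = in-C Dz z⊑x
      ... | inj₂ x⊑z with z⊑y ← proj₂ (D.between Dz) with adjacent _ x⊑z z⊑y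
      ...   | inj₁ z⊑x = in-C Dz z⊑x
      ...   | inj₂ y⊑z = inj₂ (lift (⊑-antisym z⊑y y⊑z))

  maximalChain : ∀ x → ∃ (IsMaximalChainFromTo K 0̂ x)
  maximalChain x = go x (<-wellFounded (height x))
    where
    go : ∀ x → Acc _<_ (height x) → ∃ (IsMaximalChainFromTo K 0̂ x)
    go x (acc rs) with em₂ {x ⊑ 0̂}
    ... | yes x⊑0̂ = _ , singleton-maximal x⊑0̂
    ... | no  x⋢0̂ with w , _ , w⋖x@(w⊑x , x⋢w , _) ← coatom (minimum x) x⋢0̂
                  with C , C-max ← go w (rs (height-< w⊑x x⋢w)) = _ , extend-maximal C-max w⋖x

  r-0̂ : r 0̂ ≡ 0
  r-0̂ = cong pred (hasSize-unique K (length 0̂ _ (singleton-maximal ⊑-refl))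
    (hasSize K {k = 1} (λ _ → 0̂) (λ _ → lift Eq.refl) (λ { {zero} {zero} _ → refl })
      (λ (lift z≈0̂) → zero , Eq.sym z≈0̂)))

  -- Compares the sizes of a maximal chain to `x` and of its extension by `y`; `pred` removes the
  -- extra one by which a chain has more elements than its length.
  r-⋖ : ∀ {x y} → x ⋖ y → r y ≡ suc (r x)
  r-⋖ {x} {y} x⋖y@(_ , y⋢x , _) with C , C-max@(chain , _) ← maximalChain x =
    cong pred (hasSize-unique K (length y _ (extend-maximal C-max x⋖y))
      (hasSize-insert K y inj₁ (inj₂ (lift Eq.refl))
        (λ Cz z≈y → y⋢x (⊑-trans (reflexive (Eq.sym z≈y)) (proj₂ (IsChainFromTo.between chain Cz))))
        (map₂ lower) (length x C C-max)))

  r-< : ∀ {x y} → x ⊑ y → ¬ y ⊑ x → r x < r y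
  r-< {x} {y} = go y (<-wellFounded (height y))
    where
    go : ∀ y → Acc _<_ (height y) → x ⊑ y → ¬ y ⊑ x → r x < r y
    go y (acc rs) x⊑y y⋢x with w , x⊑w , w⋖y@(w⊑y , y⋢w , _) ← coatom x⊑y y⋢x with em₂ {w ⊑ x}
    ... | yes w⊑x = ≤-reflexive (trans (cong suc (r-cong (⊑-antisym x⊑w w⊑x))) (sym (r-⋖ w⋖y)))
    ... | no  w⋢x = <-trans (go w (rs (height-< w⊑y y⋢w)) x⊑w w⋢x) (≤-reflexive (sym (r-⋖ w⋖y)))

  r-reflect : ∀ {x y} → x ⊑ y → r y ≤ r x → y ⊑ x
  r-reflect x⊑y ry≤rx = decidable-stable em₂ λ y⋢x → <⇒≱ (r-< x⊑y y⋢x) ry≤rx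

  r-mono : ∀ {x y} → x ⊑ y → r x ≤ r y
  r-mono {x} {y} x⊑y with em₂ {y ⊑ x}
  ... | yes y⊑x = ≤-reflexive (r-cong (⊑-antisym x⊑y y⊑x))
  ... | no  y⋢x = <⇒≤ (r-< x⊑y y⋢x)

  -- The join is the meet of the common upper bounds, of which `u` is one.
  join₂ : ∀ {x y u} → x ⊑ u → y ⊑ u →
          ∃[ k ] x ⊑ k × y ⊑ k × (∀ v → x ⊑ v → y ⊑ v → k ⊑ v)
  join₂ {x} {y} {u} x⊑u y⊑u
    with k , k⊑ , k-max ← meets (λ v → Lift ℓ (x ⊑ v × y ⊑ v)) (u , lift (x⊑u , y⊑u)) =
    k , k-max x (λ (lift (x⊑v , _)) → x⊑v) , k-max y (λ (lift (_ , y⊑v)) → y⊑v) ,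
    λ v x⊑v y⊑v → k⊑ (lift (x⊑v , y⊑v))

  indep-⊥ : Indep ⊥ 0̂
  indep-⊥ = ((λ i∈ → contradiction i∈ ∉⊥) , λ u _ → minimum u) , trans r-0̂ (sym (∣⊥∣≡0 atomCount))

  -- The join of `w` and `at i` lies between `w` and `k` and is not `w`, so it is `k`, whose rank is
  -- one more.
  indep-insert : ∀ {I w k i} → Indep I w → w ⋖ k → at i ⊑ k → ¬ at i ⊑ w → Indep (I ∪ ⁅ i ⁆) k
  indep-insert {I} {w} {k} {i} (lub , rw) w⋖k@(w⊑k , _ , adjacent) i⊑k i⋢w =
    lub-∪ lub w⊑k i⊑k k-min ,
    trans (r-⋖ w⋖k) (trans (cong suc rw) (sym (∣p∪⁅x⁆∣≡1+∣p∣ I (i⋢w ∘ proj₁ lub))))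
    where
    k-min : ∀ v → w ⊑ v → at i ⊑ v → k ⊑ v
    k-min v w⊑v i⊑v with l , w⊑l , i⊑l , l-min ← join₂ w⊑k i⊑k
                    with adjacent l w⊑l (l-min k w⊑k i⊑k)
    ... | inj₁ l⊑w = contradiction (⊑-trans i⊑l l⊑w) i⋢w
    ... | inj₂ k⊑l = ⊑-trans k⊑l (l-min v w⊑v i⊑v)

  -- Descend from `w` to `x` through coatoms, and add for each covering step an atom below its upper
  -- end but not its lower end.
  indep-extend : ∀ {I x w} → Indep I x → x ⊑ w → ∃[ I′ ] I ⊆ I′ × Indep I′ w
  indep-extend {I} {x} {w} I-ind@((I⊑x , x-min) , rx) = go w (<-wellFounded (height w))
    where
    go : ∀ w → Acc _<_ (height w) → x ⊑ w → ∃[ I′ ] I ⊆ I′ × Indep I′ w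
    go w (acc rs) x⊑w with em₂ {w ⊑ x}
    ... | yes w⊑x = I , id ,
      ((λ i∈I → ⊑-trans (I⊑x i∈I) x⊑w) , λ u I⊑u → ⊑-trans w⊑x (x-min u I⊑u)) ,
      trans (r-cong (⊑-antisym w⊑x x⊑w)) rx
    ... | no  w⋢x with v , x⊑v , v⋖w@(v⊑w , w⋢v , _) ← coatom x⊑w w⋢x
                  with I′ , I⊆I′ , I′-ind ← go v (rs (height-< v⊑w w⋢v)) x⊑v
                  with i , i⊑w , i⋢v ← separating w⋢v =
      I′ ∪ ⁅ i ⁆ , p⊆p∪q ⁅ i ⁆ ∘ I⊆I′ , indep-insert I′-ind v⋖w i⊑w i⋢v

  basis : ∀ x → ∃[ I ] Indep I x
  basis x with I , _ , I-ind ← indep-extend indep-⊥ (minimum x) = I , I-ind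

  -- A basis I of x extends to a basis I′ of a coatom w of x ∨ i above x.  As i is not below
  -- w, the set I′ ∪ {i} is independent, hence so is I ∪ {i}.
  cover : ∀ {x u i} → x ⊑ u → at i ⊑ u → ¬ at i ⊑ x →
          ∃[ y ] x ⊑ y × at i ⊑ y × (∀ v → x ⊑ v → at i ⊑ v → y ⊑ v) × r y ≡ suc (r x)
  cover {x} {u} {i} x⊑u i⊑u i⋢x =
    let k , x⊑k , i⊑k , k-min = join₂ x⊑u i⊑u
        w , x⊑w , w⋖k@(w⊑k , k⋢w , _) = coatom x⊑k (λ k⊑x → i⋢x (⊑-trans i⊑k k⊑x))
        I , I-ind@(I-lub , rx) = basis x
        I′ , I⊆I′ , I′-ind = indep-extend I-ind x⊑w
        I′∪i-ind = indep-insert I′-ind w⋖k i⊑k (λ i⊑w → k⋢w (k-min w x⊑w i⊑w))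
        k′ , lub , rk′ = independent⇒indep (G2.hereditary
          (∪-lub (p⊆p∪q ⁅ i ⁆ ∘ I⊆I′) (q⊆p∪q I′ ⁅ i ⁆)) (indep⇒independent I′∪i-ind))
    in k , x⊑k , i⊑k , k-min ,
       trans (r-cong (lub-unique (lub-∪ I-lub x⊑k i⊑k k-min) lub))
         (trans rk′ (trans (∣p∪⁅x⁆∣≡1+∣p∣ I (i⋢x ∘ proj₁ I-lub)) (cong suc (sym rx))))

  atomicRank : AtomicRank K atomCount
  atomicRank = record
    { 0̂ = 0̂ ; minimum = minimum ; r = r ; r-0̂ = r-0̂ ; r-mono = r-mono ; r-reflect = r-reflect
    ; at = at ; r-at = r-at ; at-injective = at-injective
    ; at-surjective = element-surjective K atoms ; atomistic = atomistic ; cover = cover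
    }

  -- A basis `I` of `x` is augmented from a basis `J ⊆ X` of `y`, which is larger; the join of the
  -- result bounds both `x` and the new atom.
  exchange : AtomicRank.Exchange atomicRank
  exchange {X} {x} {y} y-lub rx<ry =
    let j , j-lub , J , J⊆X , J-lub , rj =
          AtomicRankProperties.join-basis em K atomicRank X (proj₁ y-lub)
        I , I-ind@(I-lub , rx) = basis x
        i , i∈J , i∉I , ind = G2.augmentation (indep⇒independent I-ind)
          (indep⇒independent (J-lub , rj))
          (subst₂ _<_ rx (trans (r-cong (lub-unique y-lub j-lub)) rj) rx<ry)
        v , v-lub , rv = independent⇒indep ind
    in i , J⊆X i∈J ,
       -- Otherwise `x` would be the join of `I ∪ ⁅ i ⁆`, whose rank is `suc (r x)`.
       (λ i⊑x → 1+n≰n (≤-trans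
         (≤-reflexive (trans (cong suc rx) (trans (sym (∣p∪⁅x⁆∣≡1+∣p∣ I i∉I)) (sym rv))))
         (r-mono (lub-mono id v-lub (lub-∪ I-lub ⊑-refl i⊑x λ _ x⊑v _ → x⊑v))))) ,
       v , lub-mono (p⊆p∪q ⁅ i ⁆) I-lub v-lub , proj₁ v-lub (x∈p∪⁅x⁆ I i)

-- The equivalence and the unique simple representation, from the two constructions

theorem6p4 : ∀ {c ℓ₁ ℓ₂} → ExcludedMiddle (c ⊔ ℓ₁ ⊔ ℓ₂) →
    (K : Poset c ℓ₁ ℓ₂) →
    (IsGeometricSemilattice K ⇔ (∃[ n ] Σ[ M ∈ Semimatroid n ] K ≅ₚ flats M))
    × (IsGeometricSemilattice K →
    ∃[ n ] Σ[ M ∈ Semimatroid n ]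
    IsSimple M × K ≅ₚ flats M
    × (∀ n′ (M′ : Semimatroid n′) → IsSimple M′ → K ≅ₚ flats M′ → M ≅ₛ M′))
theorem6p4 em K =
  mk⇔ (λ G → _ , semimatroid G , K≅flats G)
      (λ (n , M , K≅M) → let open FlatsIso em K M K≅M in
        AtomicRankProperties.isGeometricSemilattice em K atomicRank exchange) ,
  λ G → _ , semimatroid G , isSimple G , K≅flats G ,
    λ n′ M′ M′-simple K≅M′ →
      simple-unique em K (semimatroid G) M′ (isSimple G) M′-simple (K≅flats G) K≅M′
  where
  module _ (G : IsGeometricSemilattice K) where
    open FromGeometric em K G using (atomicRank; exchange)
    open ToSemimatroid em K atomicRank exchange public using (semimatroid; isSimple; K≅flats)
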